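{- Let $n$ be an even nonnegative integer and let $z_n=\mathbb{E}((\det X)^2)$, where $X$ is chosen uniformly at random among the Seidel matrices of tournaments of order $n$. Then $z_n=y_n\cdot(n-1)!!$, where $y_n$ is given by the recurrence $y_0=1$, $y_2=1$, and $y_n=(n-1)y_{n-2}+(2n-4)y_{n-4}$ for even $n\ge 4$.
   Context: A tournament of order $n$ is a digraph on $\{1,\dots,n\}$ with exactly one of the arcs $ij$, $ji$ for each pair $i\ne j$. Its Seidel matrix $S=[s_{ij}]$ is the $n\times n$ skew-symmetric matrix with zero diagonal, $s_{ij}=1$ if $ij$ is an arc and $s_{ij}=-1$ otherwise; all $2^{\binom n2}$ of them are equally likely. The double factorial is defined by $0!!=1!!=1$ (and $(-1)!!=1$) and $n!!=n\cdot(n-2)!!$ for $n\ge 2$. -}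

module Defs where

open import Data.Nat as ℕ using (ℕ; zero; suc)
open import Data.Integer as ℤ using (ℤ; +_)
open import Data.Bool using (Bool; true; false; _∧_; not; _xor_; if_then_else_)
open import Data.Fin using (Fin; zero; suc; punchIn; _≟_)
open import Data.List using (List; []; _∷_; map; foldr; concatMap; filter; length; allFin)
open import Relation.Nullary.Decidable using (does)
open import Relation.Binary.PropositionalEquality using (_≡_)

sumℤ : List ℤ → ℤ
sumℤ = foldr ℤ._+_ (+ 0)

ΣFin : (n : ℕ) → (Fin n → ℤ) → ℤ
ΣFin n f = sumℤ (map f (allFin n))

det : (n : ℕ) → (Fin n → Fin n → ℤ) → ℤ
det zero M = + 1
det (suc n) M =
  ΣFin (suc n) λ j → sgn j ℤ.* (M zero j ℤ.* det n (λ i k → M (suc i) (punchIn j k)))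
  where
  sgn : {m : ℕ} → Fin m → ℤ
  sgn zero = + 1
  sgn (suc j) = ℤ.- sgn j

allFuns : {A : Set} → List A → (n : ℕ) → List (Fin n → A)
allFuns xs zero = (λ ()) ∷ []
allFuns xs (suc n) =
  concatMap (λ a → map (λ f → λ { zero → a ; (suc i) → f i }) (allFuns xs n)) xs

Digraph : ℕ → Set
Digraph n = Fin n → Fin n → Bool

allBool : List Bool
allBool = true ∷ false ∷ []

allDigraphs : (n : ℕ) → List (Digraph n)
allDigraphs n = allFuns (allFuns allBool n) n

andFin : (n : ℕ) → (Fin n → Bool) → Bool
andFin n p = foldr _∧_ true (map p (allFin n))

isTournament : {n : ℕ} → Digraph n → Bool
isTournament {n} A =
  andFin n λ i → andFin n λ j →
    if does (i ≟ j) then not (A i i) else (A i j xor A j i)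

-- The list of all tournaments of order n (each exactly once).
tournaments : (n : ℕ) → List (Digraph n)
tournaments n = filter (λ A → isTournament A ≡? true) (allDigraphs n)
  where
  open import Data.Bool.Properties using () renaming (_≟_ to _≡?_)

seidel : {n : ℕ} → Digraph n → Fin n → Fin n → ℤ
seidel A i j =
  if does (i ≟ j) then + 0 else (if A i j then + 1 else ℤ.- (+ 1))

-- Double factorial, with 0!! = 1!! = 1; (n-1)!! for n = 0 is taken as (0 ∸ 1)!! = 0!! = 1 = (-1)!!.
_!! : ℕ → ℕ
zero !! = 1
suc zero !! = 1
suc (suc n) !! = suc (suc n) ℕ.* (n !!)

-- y_0 = 1, y_2 = 1, y_n = (n-1) y_{n-2} + (2n-4) y_{n-4} for even n ≥ 4
-- (odd indices are irrelevant and set to 0).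
y : ℕ → ℕ
y zero = 1
y (suc zero) = 0
y (suc (suc zero)) = 1
y (suc (suc (suc zero))) = 0
y (suc (suc (suc (suc n)))) = (3 ℕ.+ n) ℕ.* y (suc (suc n)) ℕ.+ (4 ℕ.+ 2 ℕ.* n) ℕ.* y n

{-# OPTIONS --safe #-}

-- For a skew-symmetric A of odd order, det A = 0 and the determinant of A bordered by v is the
-- quadratic form Σ v_i v_j c_ij, where c_ij is the symmetric matrix of signed minors. Averaging the
-- square over random signs v gives (Σ c_ii)² + 2 Σ c_ij² − 2 Σ c_ii². For i ≠ j the (i,j) minor of A
-- is, up to relabelling the vertices, a bilinear form in the minors of an order n − 2 matrix,
-- evaluated at two independent sign vectors, and c_ii c_jj is a product of two quadratic forms in
-- the same minors. Hence the expectations of Σ c_ij² and of (Σ c_ii)² = Σ c_ii c_jj satisfy the same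
-- recursion and coincide. Eliminating them yields
-- z_{n+4} = (n+3)² z_{n+2} + 2(n+3)(n+2)(n+1) z_n, which is the recurrence for y_n (n−1)!!.
module Submission where

open import Defs
open import Algebra.Bundles using (CommutativeMonoid)
import Algebra.Properties.CommutativeSemigroup as CommutativeSemigroupProperties
open import Data.Bool using (Bool; true; false; _∧_; not; _xor_; if_then_else_)
open import Data.Bool.Properties as Bool using (∧-assoc; ∧-idem; ∧-commutativeMonoid; xor-comm)
open import Data.Fin using (Fin; zero; suc; punchIn; pinch; _≟_)
open import Data.Integer using (ℤ; +_; -[1+_]; -_; _+_; _*_; _^_; sign; ∣_∣; _◃_; 0ℤ; 1ℤ; -1ℤ)
open import Data.Integer.Properties
  using (+-*-semiring; +-assoc; +-comm; +-identityˡ; +-identityʳ; *-assoc; *-comm; *-identityˡ;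
         *-zeroˡ; *-zeroʳ; *-distribˡ-+; neg-involutive; suc-*; pos-*)
open import Data.Integer.Tactic.RingSolver using (solve-∀)
open import Data.List using (List; map; filter; concatMap; length; foldr; tabulate; allFin; _++_; []; _∷_)
open import Data.List.Properties using (map-cong; map-∘; map-tabulate)
open import Data.Nat as ℕ using (ℕ; zero; suc; _∸_)
open import Data.Nat.Properties as ℕₚ using ()
open import Data.Product using (_×_; _,_; proj₁)
open import Data.Sign as Sign using ()
open import Data.Vec.Functional using (Vector) renaming ([] to []ᵥ; _∷_ to _∷ᵥ_)
open import Function using (_∘_)
open import Relation.Binary.PropositionalEquality
open import Relation.Nullary.Decidable using (does)
open import Relation.Unary using (Decidable)
open import Algebra.Properties.Semiring.Sum +-*-semiring
  using (sum; sum-cong-≗; sum-remove; ∑-distrib-+; ∑-comm; *-distribˡ-sum; *-distribʳ-sum)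
open ≡-Reasoning

-- A uniform tournament on n + 1 vertices is a uniform tournament on n vertices bordered by an
-- independent uniform sign vector. So `T` is an iterated sign sum, and expectations are kept as
-- integer sums from which the count `#T` is factored out only in `Moments`. Odd order is what
-- closes the recursion. There det A = 0 removes the corner entry of a bordered matrix, and the
-- minors of A, having even order, form a symmetric matrix c. Pointwise, c_ii c_jj - c_ij c_ji is a
-- multiple of det A, so c_ii c_jj = c_ij². The argument below reaches the averaged form of this:
-- for independent v and w the mean of (Σ v_i w_j c_ij)² is Σ c_ij², while the mean of q(v) q(w),
-- with q the quadratic form of c, is (Σ c_ii)². Hence both sums reproduce themselves when the order
-- grows by two. Let z be the mean of det² at order n = 2k, s the common mean of both sums at order
-- n + 1, and z′, s′ the next values. Then z′ = 3s - 2(n+1)z, where 3 = 1 + 2 and n + 1 counts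
-- diagonal minors, and s′ = (n+3)(z′ + (n+2)s), from n + 3 diagonal and (n+3)(n+2) off-diagonal
-- positions.

Matrix : ℕ → Set
Matrix n = Fin n → Fin n → ℤ

infix 4 _≋_
_≋_ : ∀ {n} → Matrix n → Matrix n → Set
A ≋ B = ∀ i j → A i j ≡ B i j

_ᵀ : ∀ {n} → Matrix n → Matrix n
(M ᵀ) i j = M j i

minor : ∀ {n} → Fin (suc n) → Fin (suc n) → Matrix (suc n) → Matrix n
minor i j M k l = M (punchIn i k) (punchIn j l)

-- Expansion of the determinant along the first row and column; transposition.

sgn : ∀ {n} → Fin n → ℤ
sgn zero = 1ℤ
sgn (suc j) = - sgn j

sumℤ-map-tabulate : ∀ {A : Set} n (f : A → ℤ) (g : Fin n → A) →
  sumℤ (map f (tabulate g)) ≡ sum (f ∘ g)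
sumℤ-map-tabulate zero f g = refl
sumℤ-map-tabulate (suc n) f g = cong (_+_ (f (g zero))) (sumℤ-map-tabulate n f (g ∘ suc))

-- The local sign function inside det has no name outside Defs. It enters below only through the
-- underscores in the types, which unification fills in; abstracting over sign and ∣_∣ keeps the
-- product from blocking that unification.
mutual
  det-expand-list : ∀ n (M : Matrix (suc n)) → det (suc n) M ≡
    1ℤ * (M zero zero * det n (minor zero zero M)) +
    sumℤ (map (λ j → sgn j * (M zero j * det n (minor zero j M))) (tabulate suc))
  det-expand-list n M =
    cong (λ l → 1ℤ * (M zero zero * det n (minor zero zero M)) + sumℤ l)
         (map-cong (det-summand n M) (tabulate suc))

  det-summand : ∀ n (M : Matrix (suc n)) j → _ ≡ sgn j * (M zero j * det n (minor zero j M))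
  det-summand n M j with M zero j * det n (minor zero j M)
  ... | x with M | suc n | j | sign | ∣_∣
  ... | M′ | m | j′ | sg | abs =
    cong (λ a → (sg a Sign.* sg x) ◃ (abs a ℕ.* abs x)) (det-sgn n M′ j′)

  det-sgn : ∀ n (M : Matrix (suc n)) {m} (j : Fin m) → _ ≡ sgn j
  det-sgn n M zero = refl
  det-sgn n M (suc j) = cong -_ (det-sgn n M j)

det-expand : ∀ n (M : Matrix (suc n)) →
  det (suc n) M ≡ sum (λ j → sgn j * (M zero j * det n (minor zero j M)))
det-expand n M = trans (det-expand-list n M)
  (cong (_+_ (1ℤ * (M zero zero * det n (minor zero zero M))))
    (sumℤ-map-tabulate n (λ j → sgn j * (M zero j * det n (minor zero j M))) suc))

det-cong : ∀ n {M N : Matrix n} → M ≋ N → det n M ≡ det n N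
det-cong zero e = refl
det-cong (suc n) {M} {N} e = begin
  det (suc n) M ≡⟨ det-expand n M ⟩
  _             ≡⟨ sum-cong-≗ (λ j → cong₂ (λ a d → sgn j * (a * d)) (e zero j)
                     (det-cong n (λ k l → e (suc k) (punchIn j l)))) ⟩
  _             ≡⟨ det-expand n N ⟨
  det (suc n) N ∎

cofactorTerm : ∀ {n} → Vector ℤ (suc n) → Vector ℤ (suc n) → Matrix (suc n) →
  Fin (suc n) → Fin (suc n) → ℤ
cofactorTerm {n} v w A i j = (- sgn j) * (v j * (sgn i * (w i * det n (minor i j A))))

Transposable : ℕ → Set
Transposable n = ∀ M → det n (M ᵀ) ≡ det n M

-- Expanding along the first row, and then each minor down its first column, treats rows and columns
-- alike, which is what makes transposition provable. The second expansion already transposes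
-- matrices of the two smaller orders; these facts enter as hypotheses so that `det-ᵀ` can supply
-- them from its own induction.
det-bordered′ : ∀ n → Transposable n → Transposable (suc n) → (M : Matrix (suc (suc n))) →
  det (suc (suc n)) M ≡ M zero zero * det (suc n) (minor zero zero M) +
    sum λ j → sum λ i → cofactorTerm (M zero ∘ suc) (λ i → M (suc i) zero) (minor zero zero M) i j
det-bordered′ n tr tr⁺ M = trans (det-expand (suc n) M)
  (cong₂ _+_ (*-identityˡ (M zero zero * det (suc n) (minor zero zero M))) (sum-cong-≗ λ j → begin
    - sgn j * (M zero (suc j) * det (suc n) (minor zero (suc j) M))
      ≡⟨ cong (λ d → - sgn j * (M zero (suc j) * d)) (column j) ⟩
    - sgn j * (M zero (suc j) * sum (term j))
      ≡⟨ cong (- sgn j *_) (*-distribˡ-sum (M zero (suc j)) (term j)) ⟩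
    - sgn j * sum (λ i → M zero (suc j) * term j i)
      ≡⟨ *-distribˡ-sum (- sgn j) (λ i → M zero (suc j) * term j i) ⟩
    sum (λ i → - sgn j * (M zero (suc j) * term j i)) ∎))
  where
  term : Fin (suc n) → Fin (suc n) → ℤ
  term j i = sgn i * (M (suc i) zero * det n (minor i j (minor zero zero M)))
  column : ∀ j → det (suc n) (minor zero (suc j) M) ≡ sum (term j)
  column j = begin
    det (suc n) (minor zero (suc j) M) ≡⟨ tr⁺ (minor zero (suc j) M) ⟨
    det (suc n) (minor zero (suc j) M ᵀ) ≡⟨ det-expand n (minor zero (suc j) M ᵀ) ⟩
    _ ≡⟨ sum-cong-≗ (λ i → cong (λ d → sgn i * (M (suc i) zero * d)) (tr (minor i j (minor zero zero M)))) ⟩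
    _ ∎

det-ᵀ : ∀ n → Transposable n
det-ᵀ zero M = refl
det-ᵀ (suc zero) M = det-cong 1 {M ᵀ} {M} λ { zero zero → refl }
det-ᵀ (suc (suc n)) M = begin
  det (suc (suc n)) (M ᵀ)
    ≡⟨ det-bordered′ n (det-ᵀ n) (det-ᵀ (suc n)) (M ᵀ) ⟩
  M zero zero * det (suc n) (minor zero zero M ᵀ) +
    (sum λ j → sum λ i → termᵀ i j)
    ≡⟨ cong₂ (λ a b → M zero zero * a + b) (det-ᵀ (suc n) (minor zero zero M))
         (trans (∑-comm (λ j i → termᵀ i j)) (sum-cong-≗ λ i → sum-cong-≗ λ j → swap i j)) ⟩
  M zero zero * det (suc n) (minor zero zero M) +
    (sum λ i → sum λ j → cofactorTerm (M zero ∘ suc) (λ i → M (suc i) zero) (minor zero zero M) j i)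
    ≡⟨ det-bordered′ n (det-ᵀ n) (det-ᵀ (suc n)) M ⟨
  det (suc (suc n)) M ∎
  where
  rearrange : ∀ a b c d e → - a * (b * (c * (d * e))) ≡ - c * (d * (a * (b * e)))
  rearrange = solve-∀
  termᵀ : Fin (suc n) → Fin (suc n) → ℤ
  termᵀ = cofactorTerm (λ i → M (suc i) zero) (M zero ∘ suc) (minor zero zero M ᵀ)
  swap : ∀ i j → termᵀ i j
               ≡ cofactorTerm (M zero ∘ suc) (λ i → M (suc i) zero) (minor zero zero M) j i
  swap i j = trans (cong (λ d → - sgn j * (M (suc j) zero * (sgn i * (M zero (suc i) * d))))
                     (det-ᵀ n (minor j i (minor zero zero M))))
                   (rearrange (sgn j) (M (suc j) zero) (sgn i) (M zero (suc i)) _)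

det-bordered : ∀ n (M : Matrix (suc (suc n))) →
  det (suc (suc n)) M ≡ M zero zero * det (suc n) (minor zero zero M) +
    sum λ j → sum λ i → cofactorTerm (M zero ∘ suc) (λ i → M (suc i) zero) (minor zero zero M) i j
det-bordered n = det-bordered′ n (det-ᵀ n) (det-ᵀ (suc n))

-- Determinants under cyclic moves of rows and columns.

-- Moves `j` to the front. Relabellings are built from these cycles because `cycle j ∘ suc` is
-- `punchIn j` by computation, so a minor at 0 of a cycled matrix is a minor at `j` of the original.
cycle : ∀ {n} → Fin (suc n) → Fin (suc n) → Fin (suc n)
cycle j = j ∷ᵥ punchIn j

-- `pinch k j` is the position of `j` among the columns left once `punchIn j k` is deleted. This
-- lemma and the next compare the two orders in which the columns `j` and `punchIn j k` can be
-- deleted.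
punchIn-punchIn-pinch : ∀ {n} (j : Fin (suc n)) (k : Fin n) → punchIn (punchIn j k) (pinch k j) ≡ j
punchIn-punchIn-pinch zero zero = refl
punchIn-punchIn-pinch zero (suc k) = refl
punchIn-punchIn-pinch (suc j) zero = refl
punchIn-punchIn-pinch (suc j) (suc k) = cong suc (punchIn-punchIn-pinch j k)

punchIn-comm : ∀ {n} (j : Fin (suc (suc n))) (k : Fin (suc n)) l →
  punchIn (punchIn j k) (punchIn (pinch k j) l) ≡ punchIn j (punchIn k l)
punchIn-comm zero k l = refl
punchIn-comm (suc j) zero l = refl
punchIn-comm (suc j) (suc k) zero = refl
punchIn-comm {suc n} (suc j) (suc k) (suc l) = cong suc (punchIn-comm j k l)

-- The two orders of deleting a pair of columns carry opposite signs in an iterated expansion; the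
-- minus sign is that one transposition.
sgn-punchIn : ∀ {n} (j : Fin (suc n)) (k : Fin n) →
  - sgn k * sgn (pinch k j) ≡ sgn j * sgn (punchIn j k)
sgn-punchIn zero zero = refl
sgn-punchIn zero (suc k) = solve (sgn (suc k))
  where
  solve : ∀ a → - a * 1ℤ ≡ 1ℤ * - a
  solve = solve-∀
sgn-punchIn (suc j) zero = solve (sgn j)
  where
  solve : ∀ a → - 1ℤ * a ≡ - a * 1ℤ
  solve = solve-∀
sgn-punchIn (suc j) (suc k) = begin
  - - sgn k * - sgn (pinch k j) ≡⟨ solve₁ (sgn k) (sgn (pinch k j)) ⟩
  - sgn k * sgn (pinch k j)     ≡⟨ sgn-punchIn j k ⟩
  sgn j * sgn (punchIn j k)     ≡⟨ solve₂ (sgn j) (sgn (punchIn j k)) ⟩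
  - sgn j * - sgn (punchIn j k) ∎
  where
  solve₁ : ∀ a b → - - a * - b ≡ - a * b
  solve₁ = solve-∀
  solve₂ : ∀ a b → a * b ≡ - a * - b
  solve₂ = solve-∀

sgn-involutive : ∀ {n} (j : Fin n) → sgn j * sgn j ≡ 1ℤ
sgn-involutive zero = refl
sgn-involutive (suc j) = trans (neg*neg (sgn j)) (sgn-involutive j)
  where
  neg*neg : ∀ a → - a * - a ≡ a * a
  neg*neg = solve-∀

-- Induction on the order: in the expansion of the cycled matrix, the minor at column k + 1 is the
-- minor of `M` at `punchIn j k` with what was column `j` moved to the front. That is again a cycle,
-- at `pinch k j`.
det-cycleᶜ : ∀ n (M : Matrix (suc n)) j → det (suc n) (λ i k → M i (cycle j k)) ≡ sgn j * det (suc n) M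
det-cycleᶜ zero M zero =
  trans (det-cong 1 {λ i k → M i (cycle zero k)} {M} λ { zero zero → refl }) (sym (*-identityˡ _))
det-cycleᶜ (suc n) M j = begin
  det (suc (suc n)) Mᶜ
    ≡⟨ det-expand (suc n) Mᶜ ⟩
  _ ≡⟨ cong₂ _+_ (first (M zero j * det (suc n) (minor zero j M))) (sum-cong-≗ rest) ⟩
  sgn j * G j + sum (λ k → sgn j * G (punchIn j k))
    ≡⟨ sum-remove {i = j} (λ k → sgn j * G k) ⟨
  sum (λ k → sgn j * G k)
    ≡⟨ *-distribˡ-sum (sgn j) G ⟨
  sgn j * sum G
    ≡⟨ cong (sgn j *_) (det-expand (suc n) M) ⟨
  sgn j * det (suc (suc n)) M ∎
  where
  Mᶜ : Matrix (suc (suc n))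
  Mᶜ i k = M i (cycle j k)
  G : Fin (suc (suc n)) → ℤ
  G k = sgn k * (M zero k * det (suc n) (minor zero k M))
  first : ∀ x → 1ℤ * x ≡ sgn j * (sgn j * x)
  first x = trans (cong (_* x) (sym (sgn-involutive j))) (*-assoc (sgn j) (sgn j) x)
  regroup : ∀ s p a d → s * (a * (p * d)) ≡ (s * p) * (a * d)
  regroup = solve-∀
  rest : ∀ k → - sgn k * (M zero (punchIn j k) * det (suc n) (minor zero (suc k) Mᶜ)) ≡ sgn j * G (punchIn j k)
  rest k = begin
    - sgn k * (a * det (suc n) (minor zero (suc k) Mᶜ))
      ≡⟨ cong (λ d → - sgn k * (a * d)) (det-cong (suc n) λ i l → cong (M (suc i)) (columns l)) ⟩
    - sgn k * (a * det (suc n) (λ i l → N i (cycle (pinch k j) l)))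
      ≡⟨ cong (λ d → - sgn k * (a * d)) (det-cycleᶜ n N (pinch k j)) ⟩
    - sgn k * (a * (sgn (pinch k j) * det (suc n) N))
      ≡⟨ regroup (- sgn k) (sgn (pinch k j)) a (det (suc n) N) ⟩
    (- sgn k * sgn (pinch k j)) * (a * det (suc n) N)
      ≡⟨ cong (_* (a * det (suc n) N)) (sgn-punchIn j k) ⟩
    (sgn j * sgn (punchIn j k)) * (a * det (suc n) N)
      ≡⟨ *-assoc (sgn j) (sgn (punchIn j k)) _ ⟩
    sgn j * G (punchIn j k) ∎
    where
    a : ℤ
    a = M zero (punchIn j k)
    N : Matrix (suc n)
    N = minor zero (punchIn j k) M
    columns : ∀ l → cycle j (punchIn (suc k) l) ≡ punchIn (punchIn j k) (cycle (pinch k j) l)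
    columns zero = sym (punchIn-punchIn-pinch j k)
    columns (suc l) = sym (punchIn-comm j k l)

det-cycleʳ : ∀ n (M : Matrix (suc n)) j → det (suc n) (M ∘ cycle j) ≡ sgn j * det (suc n) M
det-cycleʳ n M j = begin
  det (suc n) (M ∘ cycle j)                ≡⟨ det-ᵀ (suc n) (M ∘ cycle j) ⟨
  det (suc n) (λ i k → (M ᵀ) i (cycle j k)) ≡⟨ det-cycleᶜ n (M ᵀ) j ⟩
  sgn j * det (suc n) (M ᵀ)                ≡⟨ cong (sgn j *_) (det-ᵀ (suc n) M) ⟩
  sgn j * det (suc n) M                    ∎

-- Skew-symmetric matrices of odd order and their borderings.

double : ℕ → ℕ
double zero = zero
double (suc k) = suc (suc (double k))

neg : ∀ {n} → Matrix n → Matrix n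
neg M i j = - M i j

Skew : ∀ {n} → Matrix n → Set
Skew A = A ≋ neg (A ᵀ)

det-neg : ∀ n (M : Matrix n) → det n (neg M) ≡ -1ℤ ^ n * det n M
det-neg zero M = refl
det-neg (suc n) M = begin
  det (suc n) (neg M)
    ≡⟨ det-expand n (neg M) ⟩
  _ ≡⟨ sum-cong-≗ (λ j → trans
         (cong (λ d → sgn j * (- M zero j * d)) (det-neg n (minor zero j M)))
         (regroup (sgn j) (M zero j) (-1ℤ ^ n) (det n (minor zero j M)))) ⟩
  sum (λ j → -1ℤ ^ suc n * term j)
    ≡⟨ *-distribˡ-sum (-1ℤ ^ suc n) term ⟨
  -1ℤ ^ suc n * sum term
    ≡⟨ cong (-1ℤ ^ suc n *_) (det-expand n M) ⟨
  -1ℤ ^ suc n * det (suc n) M ∎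
  where
  term : Fin (suc n) → ℤ
  term j = sgn j * (M zero j * det n (minor zero j M))
  regroup : ∀ s a p d → s * (- a * (p * d)) ≡ (-1ℤ * p) * (s * (a * d))
  regroup = solve-∀

-1^even : ∀ k → -1ℤ ^ double k ≡ 1ℤ
-1^even zero = refl
-1^even (suc k) = cong (λ x → -1ℤ * (-1ℤ * x)) (-1^even k)

self-negative⇒0 : ∀ {x} → x ≡ - x → x ≡ 0ℤ
self-negative⇒0 {+ zero} e = refl
self-negative⇒0 {+ suc n} ()
self-negative⇒0 { -[1+ n ]} ()

det-skew-odd : ∀ k {A : Matrix (suc (double k))} → Skew A → det (suc (double k)) A ≡ 0ℤ
det-skew-odd k {A} skew = self-negative⇒0 (begin
  det _ A                          ≡⟨ det-cong _ skew ⟩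
  det _ (neg (A ᵀ))                ≡⟨ det-neg _ (A ᵀ) ⟩
  -1ℤ ^ suc (double k) * det _ (A ᵀ) ≡⟨ cong₂ (λ s d → -1ℤ * s * d) (-1^even k) (det-ᵀ _ A) ⟩
  -1ℤ * 1ℤ * det _ A               ≡⟨ solve (det _ A) ⟩
  - det _ A                        ∎)
  where
  solve : ∀ d → -1ℤ * 1ℤ * d ≡ - d
  solve = solve-∀

cof : ∀ {n} → Matrix (suc n) → Matrix (suc n)
cof {n} A i j = sgn i * (sgn j * det n (minor i j A))

-- Skewness turns one minor into the negated transpose of the other, and at even order the negation
-- contributes the sign 1.
cof-sym : ∀ k {A : Matrix (suc (double k))} → Skew A → ∀ i j → cof A i j ≡ cof A j i
cof-sym k {A} skew i j = trans (cong (λ d → sgn i * (sgn j * d)) (begin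
  det _ (minor i j A)             ≡⟨ det-cong _ (λ k l → skew (punchIn i k) (punchIn j l)) ⟩
  det _ (neg (minor j i A ᵀ))     ≡⟨ det-neg _ (minor j i A ᵀ) ⟩
  -1ℤ ^ double k * det _ (minor j i A ᵀ) ≡⟨ cong₂ _*_ (-1^even k) (det-ᵀ _ (minor j i A)) ⟩
  1ℤ * det _ (minor j i A)        ≡⟨ *-identityˡ _ ⟩
  det _ (minor j i A)             ∎))
  (solve (sgn i) (sgn j) (det _ (minor j i A)))
  where
  solve : ∀ a b d → a * (b * d) ≡ b * (a * d)
  solve = solve-∀

sq : ℤ → ℤ
sq x = x * x

bilinear : ∀ {n} → Matrix n → Vector ℤ n → Vector ℤ n → ℤ
bilinear a v w = sum λ i → sum λ j → v i * (w j * a i j)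

border : ∀ {n} → Vector ℤ n → Matrix n → Matrix (suc n)
border v A zero zero = 0ℤ
border v A zero (suc j) = v j
border v A (suc i) zero = - v i
border v A (suc i) (suc j) = A i j

-- The corner of `M` is arbitrary because it multiplies det A = 0. Row and column are independent so
-- that the lemma covers both `border v A`, with v = w, and the off-diagonal minor of a doubly
-- bordered matrix, whose row and column come from different vertices.
det-skew-odd-bordered : ∀ k {A : Matrix (suc (double k))} → Skew A → (M : Matrix (suc (suc (double k)))) →
  (v w : Vector ℤ (suc (double k))) →
  (∀ j → M zero (suc j) ≡ w j) → (∀ i → M (suc i) zero ≡ - v i) → minor zero zero M ≋ A →
  det _ M ≡ bilinear (cof A) v w
det-skew-odd-bordered k {A} skew M v w row col block = begin
  det _ M
    ≡⟨ det-bordered (double k) M ⟩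
  M zero zero * det _ (minor zero zero M) + sum (λ j → sum (λ i → term i j))
    ≡⟨ cong₂ _+_ corner (trans (∑-comm (λ j i → term i j)) (sum-cong-≗ λ i → sum-cong-≗ (entry i))) ⟩
  0ℤ + bilinear (cof A) v w
    ≡⟨ +-identityˡ _ ⟩
  bilinear (cof A) v w ∎
  where
  term : Matrix (suc (double k))
  term = cofactorTerm (M zero ∘ suc) (λ i → M (suc i) zero) (minor zero zero M)
  corner : M zero zero * det _ (minor zero zero M) ≡ 0ℤ
  corner = trans (cong (M zero zero *_) (trans (det-cong _ block) (det-skew-odd k skew))) (*-zeroʳ (M zero zero))
  regroup : ∀ s b t a d → - s * (b * (t * (- a * d))) ≡ a * (b * (t * (s * d)))
  regroup = solve-∀
  entry : ∀ i j → term i j ≡ v i * (w j * cof A i j)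
  entry i j rewrite row j | col i | det-cong _ {minor i j (minor zero zero M)} {minor i j A} (λ k l → block (punchIn i k) (punchIn j l)) =
    regroup (sgn j) (w j) (sgn i) (v i) (det _ (minor i j A))

-- Moments of linear, bilinear and quadratic forms in random signs.

-- V n G is the sum of G over all vectors of signs ±1.
V : ∀ n → (Vector ℤ n → ℤ) → ℤ
V zero G = G []ᵥ
V (suc n) G = V n (G ∘ (1ℤ ∷ᵥ_)) + V n (G ∘ (-1ℤ ∷ᵥ_))

-- A common interface for sums over sign vectors, over tournaments and over lists; `L-V` exchanges
-- such a sum with a sum over signs.
record Linear {A : Set} (L : (A → ℤ) → ℤ) : Set where
  field
    L-cong : ∀ {f g} → (∀ x → f x ≡ g x) → L f ≡ L g
    L-+ : ∀ f g → L (λ x → f x + g x) ≡ L f + L g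
    L-* : ∀ c f → L (λ x → c * f x) ≡ c * L f

  L-0 : L (λ _ → 0ℤ) ≡ 0ℤ
  L-0 = trans (L-* 0ℤ (λ _ → 0ℤ)) (*-zeroˡ (L (λ _ → 0ℤ)))

  L-sum : ∀ {n} (f : Fin n → A → ℤ) → L (λ x → sum (λ i → f i x)) ≡ sum (λ i → L (f i))
  L-sum {zero} f = L-0
  L-sum {suc n} f = trans (L-+ (f zero) (λ x → sum (λ i → f (suc i) x)))
                          (cong (_+_ (L (f zero))) (L-sum (f ∘ suc)))

  L-V : ∀ n (f : Vector ℤ n → A → ℤ) → L (λ x → V n (λ v → f v x)) ≡ V n (L ∘ f)
  L-V zero f = refl
  L-V (suc n) f = trans (L-+ (λ x → V n (λ v → f (1ℤ ∷ᵥ v) x)) (λ x → V n (λ v → f (-1ℤ ∷ᵥ v) x)))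
    (cong₂ _+_ (L-V n (f ∘ (1ℤ ∷ᵥ_))) (L-V n (f ∘ (-1ℤ ∷ᵥ_))))

open Linear

+-interchange : ∀ a b c d → (a + b) + (c + d) ≡ (a + c) + (b + d)
+-interchange = solve-∀

V-linear : ∀ n → Linear (V n)
L-cong (V-linear zero) e = e []ᵥ
L-cong (V-linear (suc n)) e = cong₂ _+_ (L-cong (V-linear n) (e ∘ (1ℤ ∷ᵥ_))) (L-cong (V-linear n) (e ∘ (-1ℤ ∷ᵥ_)))
L-+ (V-linear zero) f g = refl
L-+ (V-linear (suc n)) f g =
  trans (cong₂ _+_ (L-+ (V-linear n) (f ∘ (1ℤ ∷ᵥ_)) (g ∘ (1ℤ ∷ᵥ_))) (L-+ (V-linear n) (f ∘ (-1ℤ ∷ᵥ_)) (g ∘ (-1ℤ ∷ᵥ_))))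
        (+-interchange (V n (f ∘ (1ℤ ∷ᵥ_))) (V n (g ∘ (1ℤ ∷ᵥ_))) (V n (f ∘ (-1ℤ ∷ᵥ_))) (V n (g ∘ (-1ℤ ∷ᵥ_))))
L-* (V-linear zero) c f = refl
L-* (V-linear (suc n)) c f =
  trans (cong₂ _+_ (L-* (V-linear n) c (f ∘ (1ℤ ∷ᵥ_))) (L-* (V-linear n) c (f ∘ (-1ℤ ∷ᵥ_))))
        (sym (*-distribˡ-+ c (V n (f ∘ (1ℤ ∷ᵥ_))) (V n (f ∘ (-1ℤ ∷ᵥ_)))))

V-cong : ∀ n {f g : Vector ℤ n → ℤ} → (∀ v → f v ≡ g v) → V n f ≡ V n g
V-cong n = L-cong (V-linear n)

infix 9 2^_
2^_ : ℕ → ℤ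
2^ n = (+ 2) ^ n

V-const : ∀ n c → V n (λ _ → c) ≡ 2^ n * c
V-const zero c = sym (*-identityˡ c)
V-const (suc n) c = trans (cong₂ _+_ (V-const n c) (V-const n c)) (solve (2^ n) c)
  where
  solve : ∀ p c → p * c + p * c ≡ + 2 * p * c
  solve = solve-∀

dot : ∀ {n} → Vector ℤ n → Vector ℤ n → ℤ
dot v b = sum λ i → v i * b i

-- The constant `c` strengthens the induction: splitting off one sign moves `± b zero` into it, and
-- adding the two cases cancels the cross terms.
V-sq-affine : ∀ n c (b : Vector ℤ n) →
  V n (λ v → sq (c + dot v b)) ≡ 2^ n * (sq c + sum (sq ∘ b))
V-sq-affine zero c b = solve c
  where
  solve : ∀ c → (c + 0ℤ) * (c + 0ℤ) ≡ 1ℤ * (c * c + 0ℤ)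
  solve = solve-∀
V-sq-affine (suc n) c b = begin
  V n (λ v → sq (c + (1ℤ * b zero + dot v (b ∘ suc)))) + V n (λ v → sq (c + (-1ℤ * b zero + dot v (b ∘ suc))))
    ≡⟨ cong₂ _+_ (V-cong n λ v → cong sq (plus c (b zero) (dot v (b ∘ suc))))
                 (V-cong n λ v → cong sq (minus c (b zero) (dot v (b ∘ suc)))) ⟩
  V n (λ v → sq ((c + b zero) + dot v (b ∘ suc))) + V n (λ v → sq ((c + - b zero) + dot v (b ∘ suc)))
    ≡⟨ cong₂ _+_ (V-sq-affine n (c + b zero) (b ∘ suc)) (V-sq-affine n (c + - b zero) (b ∘ suc)) ⟩
  2^ n * (sq (c + b zero) + S) + 2^ n * (sq (c + - b zero) + S)
    ≡⟨ parallelogram (2^ n) c (b zero) S ⟩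
  2^ suc n * (sq c + (sq (b zero) + S)) ∎
  where
  S : ℤ
  S = sum (sq ∘ b ∘ suc)
  plus : ∀ c x d → c + (1ℤ * x + d) ≡ (c + x) + d
  plus = solve-∀
  minus : ∀ c x d → c + (-1ℤ * x + d) ≡ (c + - x) + d
  minus = solve-∀
  parallelogram : ∀ p c x s → p * ((c + x) * (c + x) + s) + p * ((c + - x) * (c + - x) + s)
    ≡ + 2 * p * (c * c + (x * x + s))
  parallelogram = solve-∀

V-sq-dot : ∀ n (b : Vector ℤ n) → V n (λ v → sq (dot v b)) ≡ 2^ n * sum (sq ∘ b)
V-sq-dot n b = begin
  V n (λ v → sq (dot v b))      ≡⟨ V-cong n (λ v → cong sq (sym (+-identityˡ (dot v b)))) ⟩
  V n (λ v → sq (0ℤ + dot v b)) ≡⟨ V-sq-affine n 0ℤ b ⟩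
  2^ n * (0ℤ + sum (sq ∘ b))    ≡⟨ cong (2^ n *_) (+-identityˡ _) ⟩
  2^ n * sum (sq ∘ b)           ∎

trace frobenius diagonal : ∀ {n} → Matrix n → ℤ
trace a = sum λ i → a i i
frobenius a = sum λ i → sum λ j → sq (a i j)
diagonal a = sum λ i → sq (a i i)

-- For fixed v the form is linear in w, with coefficients linear in v, so `V-sq-dot` applies to w
-- and then to each coefficient.
V-sq-bilinear : ∀ n (a : Matrix n) →
  V n (λ v → V n (λ w → sq (bilinear a v w))) ≡ 2^ n * (2^ n * frobenius a)
V-sq-bilinear n a = begin
  V n (λ v → V n (λ w → sq (bilinear a v w)))
    ≡⟨ V-cong n (λ v → V-cong n (λ w → cong sq (factor v w))) ⟩
  V n (λ v → V n (λ w → sq (dot w (λ j → dot v (λ i → a i j)))))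
    ≡⟨ V-cong n (λ v → V-sq-dot n (λ j → dot v (λ i → a i j))) ⟩
  V n (λ v → 2^ n * sum (λ j → sq (dot v (λ i → a i j))))
    ≡⟨ L-* (V-linear n) (2^ n) _ ⟩
  2^ n * V n (λ v → sum (λ j → sq (dot v (λ i → a i j))))
    ≡⟨ cong (2^ n *_) (L-sum (V-linear n) (λ j v → sq (dot v (λ i → a i j)))) ⟩
  2^ n * sum (λ j → V n (λ v → sq (dot v (λ i → a i j))))
    ≡⟨ cong (2^ n *_) (sum-cong-≗ (λ j → V-sq-dot n (λ i → a i j))) ⟩
  2^ n * sum (λ j → 2^ n * sum (λ i → sq (a i j)))
    ≡⟨ cong (2^ n *_) (*-distribˡ-sum (2^ n) (λ j → sum (λ i → sq (a i j)))) ⟨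
  2^ n * (2^ n * sum (λ j → sum (λ i → sq (a i j))))
    ≡⟨ cong (λ s → 2^ n * (2^ n * s)) (∑-comm (λ j i → sq (a i j))) ⟩
  2^ n * (2^ n * frobenius a) ∎
  where
  swap : ∀ x y z → x * (y * z) ≡ y * (x * z)
  swap = solve-∀
  factor : ∀ v w → bilinear a v w ≡ dot w (λ j → dot v (λ i → a i j))
  factor v w = begin
    sum (λ i → sum (λ j → v i * (w j * a i j))) ≡⟨ ∑-comm (λ i j → v i * (w j * a i j)) ⟩
    sum (λ j → sum (λ i → v i * (w j * a i j))) ≡⟨ sum-cong-≗ (λ j → sum-cong-≗ (λ i → swap (v i) (w j) (a i j))) ⟩
    sum (λ j → sum (λ i → w j * (v i * a i j))) ≡⟨ sum-cong-≗ (λ j → *-distribˡ-sum (w j) (λ i → v i * a i j)) ⟨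
    dot w (λ j → dot v (λ i → a i j)) ∎

Symmetric : ∀ {n} → Matrix n → Set
Symmetric a = ∀ i j → a i j ≡ a j i

quadratic : ∀ {n} → Matrix n → Vector ℤ n → ℤ
quadratic a v = bilinear a v v

firstRow : ∀ {n} → Matrix (suc n) → Vector ℤ n → ℤ
firstRow a v = dot v (λ i → + 2 * a zero (suc i))

-- Isolates the part odd in the sign e. Adding the cases e = 1 and e = -1 cancels it in the form,
-- and leaves only its own square in the squared form.
quadratic-∷ : ∀ {n} (a : Matrix (suc n)) → Symmetric a → ∀ e v →
  quadratic a (e ∷ᵥ v) ≡ e * e * a zero zero + quadratic (minor zero zero a) v + e * firstRow a v
quadratic-∷ a sym-a e v = begin
  e * (e * a zero zero) + sum (λ j → e * (v j * a zero (suc j))) +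
    sum (λ i → v i * (e * a (suc i) zero) + sum (λ j → v i * (v j * a (suc i) (suc j))))
    ≡⟨ cong₂ (λ x y → e * (e * a zero zero) + x + y)
         (sym (*-distribˡ-sum e (λ j → v j * a zero (suc j))))
         (∑-distrib-+ (λ i → v i * (e * a (suc i) zero)) (λ i → sum (λ j → v i * (v j * a (suc i) (suc j))))) ⟩
  e * (e * a zero zero) + e * r + (sum (λ i → v i * (e * a (suc i) zero)) + quadratic (minor zero zero a) v)
    ≡⟨ cong (λ x → e * (e * a zero zero) + e * r + (x + quadratic (minor zero zero a) v))
         (trans (sum-cong-≗ λ i → trans (cong (λ x → v i * (e * x)) (sym-a (suc i) zero)) (swap (v i) e (a zero (suc i))))
                (sym (*-distribˡ-sum e (λ j → v j * a zero (suc j))))) ⟩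
  e * (e * a zero zero) + e * r + (e * r + quadratic (minor zero zero a) v)
    ≡⟨ collect e (a zero zero) r (quadratic (minor zero zero a) v) ⟩
  e * e * a zero zero + quadratic (minor zero zero a) v + e * (+ 2 * r)
    ≡⟨ cong (λ x → e * e * a zero zero + quadratic (minor zero zero a) v + e * x)
         (trans (*-distribˡ-sum (+ 2) (λ j → v j * a zero (suc j))) (sum-cong-≗ λ j → swap (+ 2) (v j) (a zero (suc j)))) ⟩
  e * e * a zero zero + quadratic (minor zero zero a) v + e * firstRow a v ∎
  where
  r : ℤ
  r = sum (λ j → v j * a zero (suc j))
  swap : ∀ x y z → x * (y * z) ≡ y * (x * z)
  swap = solve-∀
  collect : ∀ e a r q → e * (e * a) + e * r + (e * r + q) ≡ e * e * a + q + e * (+ 2 * r)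
  collect = solve-∀

V-quadratic : ∀ n (a : Matrix n) → Symmetric a → V n (quadratic a) ≡ 2^ n * trace a
V-quadratic zero a sym-a = refl
V-quadratic (suc n) a sym-a = begin
  V n (quadratic a ∘ (1ℤ ∷ᵥ_)) + V n (quadratic a ∘ (-1ℤ ∷ᵥ_))
    ≡⟨ L-+ (V-linear n) (quadratic a ∘ (1ℤ ∷ᵥ_)) (quadratic a ∘ (-1ℤ ∷ᵥ_)) ⟨
  V n (λ v → quadratic a (1ℤ ∷ᵥ v) + quadratic a (-1ℤ ∷ᵥ v))
    ≡⟨ V-cong n (λ v → trans (cong₂ _+_ (quadratic-∷ a sym-a 1ℤ v) (quadratic-∷ a sym-a -1ℤ v))
         (cancel (a zero zero) (quadratic a′ v) (firstRow a v))) ⟩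
  V n (λ v → + 2 * a zero zero + + 2 * quadratic a′ v)
    ≡⟨ L-+ (V-linear n) (λ _ → + 2 * a zero zero) (λ v → + 2 * quadratic a′ v) ⟩
  V n (λ _ → + 2 * a zero zero) + V n (λ v → + 2 * quadratic a′ v)
    ≡⟨ cong₂ _+_ (V-const n (+ 2 * a zero zero)) (trans (L-* (V-linear n) (+ 2) (quadratic a′))
         (cong (+ 2 *_) (V-quadratic n a′ (λ i j → sym-a (suc i) (suc j))))) ⟩
  2^ n * (+ 2 * a zero zero) + + 2 * (2^ n * trace a′)
    ≡⟨ collect (2^ n) (a zero zero) (trace a′) ⟩
  2^ suc n * trace a ∎
  where
  a′ : Matrix n
  a′ = minor zero zero a
  cancel : ∀ c q r → (1ℤ * 1ℤ * c + q + 1ℤ * r) + (-1ℤ * -1ℤ * c + q + -1ℤ * r) ≡ + 2 * c + + 2 * q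
  cancel = solve-∀
  collect : ∀ p c t → p * (+ 2 * c) + + 2 * (p * t) ≡ + 2 * p * (c + t)
  collect = solve-∀

-- By symmetry the product v_i v_j with i < j has coefficient 2 a_ij, and distinct such products are
-- orthogonal. The mean square is therefore (tr a)² plus 4 Σ a_ij² over i < j, which the Frobenius
-- and diagonal sums express without an order on indices.
V-sq-quadratic : ∀ n (a : Matrix n) → Symmetric a →
  V n (sq ∘ quadratic a) ≡ 2^ n * (sq (trace a) + + 2 * frobenius a + - (+ 2 * diagonal a))
V-sq-quadratic zero a sym-a = refl
V-sq-quadratic (suc n) a sym-a = begin
  V n (sq ∘ quadratic a ∘ (1ℤ ∷ᵥ_)) + V n (sq ∘ quadratic a ∘ (-1ℤ ∷ᵥ_))
    ≡⟨ L-+ (V-linear n) (sq ∘ quadratic a ∘ (1ℤ ∷ᵥ_)) (sq ∘ quadratic a ∘ (-1ℤ ∷ᵥ_)) ⟨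
  V n (λ v → sq (quadratic a (1ℤ ∷ᵥ v)) + sq (quadratic a (-1ℤ ∷ᵥ v)))
    ≡⟨ V-cong n (λ v → trans (cong₂ (λ x y → sq x + sq y) (quadratic-∷ a sym-a 1ℤ v) (quadratic-∷ a sym-a -1ℤ v))
         (expand c (quadratic a′ v) (firstRow a v))) ⟩
  V n (λ v → (+ 2 * (c * c) + + 4 * c * quadratic a′ v) + (+ 2 * sq (quadratic a′ v) + + 2 * sq (firstRow a v)))
    ≡⟨ L-+ (V-linear n) (λ v → + 2 * (c * c) + + 4 * c * quadratic a′ v)
                        (λ v → + 2 * sq (quadratic a′ v) + + 2 * sq (firstRow a v)) ⟩
  V n (λ v → + 2 * (c * c) + + 4 * c * quadratic a′ v) + V n (λ v → + 2 * sq (quadratic a′ v) + + 2 * sq (firstRow a v))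
    ≡⟨ cong₂ _+_
         (trans (L-+ (V-linear n) (λ _ → + 2 * (c * c)) (λ v → + 4 * c * quadratic a′ v))
           (cong₂ _+_ (V-const n (+ 2 * (c * c))) (trans (L-* (V-linear n) (+ 4 * c) (quadratic a′))
             (cong (+ 4 * c *_) (V-quadratic n a′ sym-a′)))))
         (trans (L-+ (V-linear n) (λ v → + 2 * sq (quadratic a′ v)) (λ v → + 2 * sq (firstRow a v)))
           (cong₂ _+_ (trans (L-* (V-linear n) (+ 2) (sq ∘ quadratic a′)) (cong (+ 2 *_) (V-sq-quadratic n a′ sym-a′)))
             (trans (L-* (V-linear n) (+ 2) (sq ∘ firstRow a))
               (cong (+ 2 *_) (trans (V-sq-dot n (λ i → + 2 * a zero (suc i))) (cong (2^ n *_) row)))))) ⟩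
  (2^ n * (+ 2 * (c * c)) + + 4 * c * (2^ n * trace a′)) +
    (+ 2 * (2^ n * (sq (trace a′) + + 2 * frobenius a′ + - (+ 2 * diagonal a′))) + + 2 * (2^ n * (+ 4 * s)))
    ≡⟨ collect (2^ n) c (trace a′) (frobenius a′) (diagonal a′) s ⟩
  2^ suc n * (sq (trace a) + + 2 * ((sq c + s) + (s + frobenius a′)) + - (+ 2 * diagonal a))
    -- One copy of `s` is row 0 of the Frobenius sum; by symmetry the other becomes column 0.
    ≡⟨ cong (λ x → 2^ suc n * (sq (trace a) + + 2 * ((sq c + s) + x) + - (+ 2 * diagonal a)))
         (trans (cong (_+ frobenius a′) (sum-cong-≗ λ i → cong sq (sym-a zero (suc i))))
                (sym (∑-distrib-+ (λ i → sq (a (suc i) zero)) (λ i → sum (λ j → sq (a (suc i) (suc j))))))) ⟩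
  2^ suc n * (sq (trace a) + + 2 * frobenius a + - (+ 2 * diagonal a)) ∎
  where
  a′ : Matrix n
  a′ = minor zero zero a
  sym-a′ : Symmetric a′
  sym-a′ i j = sym-a (suc i) (suc j)
  c s : ℤ
  c = a zero zero
  s = sum (λ i → sq (a zero (suc i)))
  sq-twice : ∀ x → (+ 2 * x) * (+ 2 * x) ≡ + 4 * (x * x)
  sq-twice = solve-∀
  row : sum (λ i → sq (+ 2 * a zero (suc i))) ≡ + 4 * s
  row = trans (sum-cong-≗ λ i → sq-twice (a zero (suc i))) (sym (*-distribˡ-sum (+ 4) (λ i → sq (a zero (suc i)))))
  expand : ∀ c q r → (1ℤ * 1ℤ * c + q + 1ℤ * r) * (1ℤ * 1ℤ * c + q + 1ℤ * r) +
    (-1ℤ * -1ℤ * c + q + -1ℤ * r) * (-1ℤ * -1ℤ * c + q + -1ℤ * r) ≡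
    (+ 2 * (c * c) + + 4 * c * q) + (+ 2 * (q * q) + + 2 * (r * r))
  expand = solve-∀
  collect : ∀ p c t f d s →
    (p * (+ 2 * (c * c)) + + 4 * c * (p * t)) +
    (+ 2 * (p * (t * t + + 2 * f + - (+ 2 * d))) + + 2 * (p * (+ 4 * s))) ≡
    + 2 * p * ((c + t) * (c + t) + + 2 * ((c * c + s) + (s + f)) + - (+ 2 * (c * c + d)))
  collect = solve-∀

-- Sums over tournaments and their invariance under relabelling.

-- T n F is the sum of F over all Seidel matrices of tournaments of order n.
T : ∀ n → (Matrix n → ℤ) → ℤ
T zero F = F λ ()
T (suc n) F = V n λ v → T n (F ∘ border v)

border-skew : ∀ {n} v {A : Matrix n} → Skew A → Skew (border v A)
border-skew v skew zero zero = refl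
border-skew v skew zero (suc j) = sym (neg-involutive (v j))
border-skew v skew (suc i) zero = refl
border-skew v skew (suc i) (suc j) = skew i j

-- Providing `Skew A` to the pointwise hypothesis is what allows the identities for skew matrices to
-- be used under the sum.
T-cong : ∀ n {F G : Matrix n → ℤ} → (∀ A → Skew A → F A ≡ G A) → T n F ≡ T n G
T-cong zero e = e (λ ()) (λ ())
T-cong (suc n) e = V-cong n λ v → T-cong n λ A skew → e (border v A) (border-skew v skew)

T-linear : ∀ n → Linear (T n)
L-cong (T-linear n) e = T-cong n (λ A _ → e A)
L-+ (T-linear zero) F G = refl
L-+ (T-linear (suc n)) F G = trans (V-cong n λ v → L-+ (T-linear n) (F ∘ border v) (G ∘ border v))
  (L-+ (V-linear n) (λ v → T n (F ∘ border v)) (λ v → T n (G ∘ border v)))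
L-* (T-linear zero) c F = refl
L-* (T-linear (suc n)) c F = trans (V-cong n λ v → L-* (T-linear n) c (F ∘ border v))
  (L-* (V-linear n) c (λ v → T n (F ∘ border v)))

-- Takes the place of function extensionality: matrices built in different ways agree only entry by
-- entry.
Respects : ∀ {n} → (Matrix n → ℤ) → Set
Respects F = ∀ {A B} → A ≋ B → F A ≡ F B

relabel : ∀ {m n} → (Fin m → Fin n) → Matrix n → Matrix m
relabel π A i j = A (π i) (π j)

lift : ∀ {m n} → (Fin m → Fin n) → Fin (suc m) → Fin (suc n)
lift π zero = zero
lift π (suc i) = suc (π i)

swap₀₁ : ∀ {n} → Fin (suc (suc n)) → Fin (suc (suc n))
swap₀₁ = cycle (suc zero)

cycle-suc : ∀ {n} (j : Fin (suc n)) i → cycle (suc j) i ≡ lift (cycle j) (swap₀₁ i)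
cycle-suc j zero = refl
cycle-suc j (suc zero) = refl
cycle-suc j (suc (suc i)) = refl

cycle-zero : ∀ {n} (i : Fin (suc n)) → cycle zero i ≡ i
cycle-zero zero = refl
cycle-zero (suc i) = refl

V-cycle : ∀ n j {G : Vector ℤ (suc n) → ℤ} → (∀ {v w} → (∀ i → v i ≡ w i) → G v ≡ G w) →
  V (suc n) (λ v → G (v ∘ cycle j)) ≡ V (suc n) G
V-cycle n zero G-cong = V-cong (suc n) λ v → G-cong (cong v ∘ cycle-zero)
V-cycle (suc n) (suc j) {G} G-cong = begin
  V (suc n) (λ v → G ((1ℤ ∷ᵥ v) ∘ cycle (suc j))) + V (suc n) (λ v → G ((-1ℤ ∷ᵥ v) ∘ cycle (suc j)))
    ≡⟨ cong₂ _+_ (step 1ℤ) (step -1ℤ) ⟩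
  V (suc n) (λ v → G ((1ℤ ∷ᵥ v) ∘ swap₀₁)) + V (suc n) (λ v → G ((-1ℤ ∷ᵥ v) ∘ swap₀₁))
    ≡⟨⟩
  (g 1ℤ 1ℤ + g 1ℤ -1ℤ) + (g -1ℤ 1ℤ + g -1ℤ -1ℤ)
    ≡⟨ +-interchange (g 1ℤ 1ℤ) (g 1ℤ -1ℤ) (g -1ℤ 1ℤ) (g -1ℤ -1ℤ) ⟩
  (g 1ℤ 1ℤ + g -1ℤ 1ℤ) + (g 1ℤ -1ℤ + g -1ℤ -1ℤ)
    ≡⟨ cong₂ _+_ (cong₂ _+_ (swapped 1ℤ 1ℤ) (swapped -1ℤ 1ℤ)) (cong₂ _+_ (swapped 1ℤ -1ℤ) (swapped -1ℤ -1ℤ)) ⟩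
  V (suc (suc n)) G ∎
  where
  g : ℤ → ℤ → ℤ
  g a b = V n (λ v → G ((a ∷ᵥ b ∷ᵥ v) ∘ swap₀₁))
  swapped : ∀ a b → g a b ≡ V n (λ v → G (b ∷ᵥ a ∷ᵥ v))
  swapped a b = V-cong n λ v → G-cong λ { zero → refl ; (suc zero) → refl ; (suc (suc i)) → refl }
  step : ∀ a → V (suc n) (λ v → G ((a ∷ᵥ v) ∘ cycle (suc j))) ≡ V (suc n) (λ v → G ((a ∷ᵥ v) ∘ swap₀₁))
  step a = trans
    (V-cong (suc n) λ v → G-cong {(a ∷ᵥ v) ∘ cycle (suc j)} {(a ∷ᵥ (v ∘ cycle j)) ∘ swap₀₁}
      λ { zero → refl ; (suc zero) → refl ; (suc (suc i)) → refl })
    (V-cycle n j {λ v → G ((a ∷ᵥ v) ∘ swap₀₁)} λ e → G-cong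
      λ { zero → e zero ; (suc zero) → refl ; (suc (suc i)) → e (suc i) })

border-cong : ∀ {n} {v w : Vector ℤ n} {A B : Matrix n} → (∀ i → v i ≡ w i) → A ≋ B → border v A ≋ border w B
border-cong e E zero zero = refl
border-cong e E zero (suc j) = e j
border-cong e E (suc i) zero = cong -_ (e i)
border-cong e E (suc i) (suc j) = E i j

-- Relabelling all vertices except 0 acts separately on the border vector and on the smaller matrix.
-- Invariance at the smaller order is a hypothesis, supplied by the induction in `T-cycle`.
T-lift : ∀ n j {F : Matrix (suc (suc n)) → ℤ} → Respects F →
  (∀ {G : Matrix (suc n) → ℤ} → Respects G → T (suc n) (G ∘ relabel (cycle j)) ≡ T (suc n) G) →
  T (suc (suc n)) (F ∘ relabel (lift (cycle j))) ≡ T (suc (suc n)) F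
T-lift n j {F} F-cong T-cyc = begin
  V (suc n) (λ v → T (suc n) (λ A → F (relabel (lift (cycle j)) (border v A))))
    ≡⟨ V-cong (suc n) (λ v → T-cong (suc n) λ A _ → F-cong (commute v A)) ⟩
  V (suc n) (λ v → T (suc n) (λ A → F (border (v ∘ cycle j) (relabel (cycle j) A))))
    ≡⟨ V-cong (suc n) (λ v → T-cyc {F ∘ border (v ∘ cycle j)} (λ E → F-cong (border-cong (λ _ → refl) E))) ⟩
  V (suc n) (λ v → T (suc n) (λ A → F (border (v ∘ cycle j) A)))
    ≡⟨ V-cycle n j {λ v → T (suc n) (F ∘ border v)}
         (λ e → T-cong (suc n) λ A _ → F-cong (border-cong {A = A} {A} e (λ _ _ → refl))) ⟩
  T (suc (suc n)) F ∎
  where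
  commute : ∀ v A → relabel (lift (cycle j)) (border v A) ≋ border (v ∘ cycle j) (relabel (cycle j) A)
  commute v A zero zero = refl
  commute v A zero (suc l) = refl
  commute v A (suc k) zero = refl
  commute v A (suc k) (suc l) = refl

-- The swap exchanges the sign vectors of the vertices 0 and 1 towards the rest, which is an
-- exchange of summations, and reverses the arc between them, which permutes the two values of its
-- sign.
T-swap₀₁ : ∀ n {F : Matrix (suc (suc n)) → ℤ} → Respects F →
  T (suc (suc n)) (F ∘ relabel swap₀₁) ≡ T (suc (suc n)) F
T-swap₀₁ n {F} F-cong = begin
  f′ 1ℤ + f′ -1ℤ  ≡⟨ cong₂ _+_ (swapped 1ℤ) (swapped -1ℤ) ⟩
  f -1ℤ + f 1ℤ    ≡⟨ +-comm (f -1ℤ) (f 1ℤ) ⟩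
  f 1ℤ + f -1ℤ    ∎
  where
  f f′ : ℤ → ℤ
  f a = V n λ v → V n λ w → T n λ A → F (border (a ∷ᵥ v) (border w A))
  f′ a = V n λ v → V n λ w → T n λ A → F (relabel swap₀₁ (border (a ∷ᵥ v) (border w A)))
  swap-border : ∀ a v w A → relabel swap₀₁ (border (a ∷ᵥ v) (border w A)) ≋ border (- a ∷ᵥ w) (border v A)
  swap-border a v w A zero zero = refl
  swap-border a v w A zero (suc zero) = refl
  swap-border a v w A zero (suc (suc j)) = refl
  swap-border a v w A (suc zero) zero = sym (neg-involutive a)
  swap-border a v w A (suc zero) (suc zero) = refl
  swap-border a v w A (suc zero) (suc (suc j)) = refl
  swap-border a v w A (suc (suc i)) zero = refl
  swap-border a v w A (suc (suc i)) (suc zero) = refl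
  swap-border a v w A (suc (suc i)) (suc (suc j)) = refl
  swapped : ∀ a → f′ a ≡ f (- a)
  swapped a = trans
    (V-cong n λ v → V-cong n λ w → T-cong n λ A _ → F-cong (swap-border a v w A))
    (L-V (V-linear n) n λ w v → T n λ A → F (border (- a ∷ᵥ w) (border v A)))

-- By `cycle-suc`, a cycle is composed of the swap of 0 and 1 and a smaller cycle that fixes 0.
T-cycle : ∀ n j {F : Matrix (suc n) → ℤ} → Respects F →
  T (suc n) (F ∘ relabel (cycle j)) ≡ T (suc n) F
T-cycle n zero F-cong = T-cong (suc n) λ A _ → F-cong λ k l → cong₂ A (cycle-zero k) (cycle-zero l)
T-cycle (suc n) (suc j) {F} F-cong = begin
  T (suc (suc n)) (F ∘ relabel (cycle (suc j)))
    ≡⟨ T-cong (suc (suc n)) (λ A _ → F-cong λ k l → cong₂ A (cycle-suc j k) (cycle-suc j l)) ⟩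
  T (suc (suc n)) (F ∘ relabel swap₀₁ ∘ relabel (lift (cycle j)))
    ≡⟨ T-lift n j {F ∘ relabel swap₀₁} (λ E → F-cong λ k l → E (swap₀₁ k) (swap₀₁ l)) (T-cycle n j) ⟩
  T (suc (suc n)) (F ∘ relabel swap₀₁)
    ≡⟨ T-swap₀₁ n F-cong ⟩
  T (suc (suc n)) F ∎

-- Double sums over vertices, reduced to the pairs (0, 0) and (0, 1).

-- Sends 0 to `i` and 1 to `punchIn i j`; every ordered pair of distinct vertices has this form.
twoPoint : ∀ {n} → Fin (suc (suc n)) → Fin (suc n) → Fin (suc (suc n)) → Fin (suc (suc n))
twoPoint i j = cycle i ∘ lift (cycle j)

T-twoPoint : ∀ n i j {F : Matrix (suc (suc n)) → ℤ} → Respects F →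
  T (suc (suc n)) (F ∘ relabel (twoPoint i j)) ≡ T (suc (suc n)) F
T-twoPoint n i j {F} F-cong = trans
  (T-cycle (suc n) i {F ∘ relabel (lift (cycle j))} (λ E → F-cong λ k l → E (lift (cycle j) k) (lift (cycle j) l)))
  (T-lift n j F-cong (T-cycle n j))

record Equivariant {n} (f : Fin (suc (suc n)) → Fin (suc (suc n)) → Matrix (suc (suc n)) → ℤ) : Set where
  field
    respects : ∀ i j → Respects (f i j)
    one : ∀ i A → f i i A ≡ f zero zero (relabel (cycle i) A)
    two : ∀ i j A → f i (punchIn i j) A ≡ f zero (suc zero) (relabel (twoPoint i j) A)

sum-const : ∀ n c → sum {n} (λ _ → c) ≡ + n * c
sum-const zero c = sym (*-zeroˡ c)
sum-const (suc n) c = trans (cong (_+_ c) (sum-const n c)) (sym (suc-* (+ n) c))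

T-double-sum : ∀ n {f} → Equivariant {n} f →
  T (suc (suc n)) (λ A → sum λ i → sum λ j → f i j A) ≡
    + suc (suc n) * (T (suc (suc n)) (f zero zero) + + suc n * T (suc (suc n)) (f zero (suc zero)))
T-double-sum n {f} eq = begin
  T (suc (suc n)) (λ A → sum λ i → sum λ j → f i j A)
    ≡⟨ L-sum (T-linear (suc (suc n))) (λ i A → sum λ j → f i j A) ⟩
  sum (λ i → T (suc (suc n)) (λ A → sum λ j → f i j A))
    ≡⟨ sum-cong-≗ (λ i → trans (L-sum (T-linear (suc (suc n))) (f i)) (sum-remove {i = i} (λ j → T (suc (suc n)) (f i j)))) ⟩
  sum (λ i → T (suc (suc n)) (f i i) + sum (λ j → T (suc (suc n)) (f i (punchIn i j))))
    ≡⟨ sum-cong-≗ (λ i → cong₂ _+_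
         (trans (T-cong (suc (suc n)) λ A _ → one i A) (T-cycle (suc n) i (respects zero zero)))
         (trans (sum-cong-≗ λ j →
             trans (T-cong (suc (suc n)) λ A _ → two i j A) (T-twoPoint n i j (respects zero (suc zero))))
           (sum-const (suc n) t₁))) ⟩
  sum {suc (suc n)} (λ _ → t₀ + + suc n * t₁)
    ≡⟨ sum-const (suc (suc n)) (t₀ + + suc n * t₁) ⟩
  + suc (suc n) * (t₀ + + suc n * t₁) ∎
  where
  open Equivariant eq
  t₀ t₁ : ℤ
  t₀ = T (suc (suc n)) (f zero zero)
  t₁ = T (suc (suc n)) (f zero (suc zero))

det-relabel-cycle : ∀ n j (A : Matrix (suc n)) → det (suc n) (relabel (cycle j) A) ≡ det (suc n) A
det-relabel-cycle n j A = begin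
  det (suc n) (relabel (cycle j) A)            ≡⟨ det-cycleᶜ n (A ∘ cycle j) j ⟩
  sgn j * det (suc n) (A ∘ cycle j)            ≡⟨ cong (sgn j *_) (det-cycleʳ n A j) ⟩
  sgn j * (sgn j * det (suc n) A)              ≡⟨ *-assoc (sgn j) (sgn j) _ ⟨
  sgn j * sgn j * det (suc n) A                ≡⟨ cong (_* det (suc n) A) (sgn-involutive j) ⟩
  1ℤ * det (suc n) A                           ≡⟨ *-identityˡ _ ⟩
  det (suc n) A                                ∎

sq-sgn-* : ∀ {n} (j : Fin n) x → sq (sgn j * x) ≡ sq x
sq-sgn-* j x = begin
  sq (sgn j * x)     ≡⟨ regroup (sgn j) x ⟩
  sgn j * sgn j * sq x ≡⟨ cong (_* sq x) (sgn-involutive j) ⟩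
  1ℤ * sq x          ≡⟨ *-identityˡ (sq x) ⟩
  sq x               ∎
  where
  regroup : ∀ s x → (s * x) * (s * x) ≡ s * s * (x * x)
  regroup = solve-∀

minorSq minorProduct : ∀ {n} → Fin (suc n) → Fin (suc n) → Matrix (suc n) → ℤ
minorSq {n} i j A = sq (det n (minor i j A))
minorProduct {n} i j A = det n (minor i i A) * det n (minor j j A)

minor-cong : ∀ {n} i j {A B : Matrix (suc n)} → A ≋ B → minor i j A ≋ minor i j B
minor-cong i j E k l = E (punchIn i k) (punchIn j l)

twoPoint-punchIn₁ : ∀ {n} (i : Fin (suc (suc n))) (j : Fin (suc n)) k →
  twoPoint i j (punchIn (suc zero) k) ≡ punchIn (punchIn i j) (cycle (pinch j i) k)
twoPoint-punchIn₁ i j zero = sym (punchIn-punchIn-pinch i j)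
twoPoint-punchIn₁ {suc n} i j (suc k) = sym (punchIn-comm i j k)

-- The minor at (0, 1) of the relabelled matrix is the minor at `i` and `punchIn i j` with rows and
-- columns moved by two different cycles. The two agree up to sign, and squaring removes the sign.
minorSq-equivariant : ∀ n → Equivariant {n} minorSq
minorSq-equivariant n = record
  { respects = λ i j E → cong sq (det-cong (suc n) (minor-cong i j E))
  ; one = λ i A → refl
  ; two = λ i j A → sym (begin
      sq (det (suc n) (minor zero (suc zero) (relabel (twoPoint i j) A)))
        ≡⟨ cong sq (det-cong (suc n) λ k l → cong (A (punchIn i (cycle j k))) (twoPoint-punchIn₁ i j l)) ⟩
      sq (det (suc n) (λ k l → minor i (punchIn i j) A (cycle j k) (cycle (pinch j i) l)))
        ≡⟨ cong sq (det-cycleᶜ n (minor i (punchIn i j) A ∘ cycle j) (pinch j i)) ⟩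
      sq (sgn (pinch j i) * det (suc n) (minor i (punchIn i j) A ∘ cycle j))
        ≡⟨ sq-sgn-* (pinch j i) _ ⟩
      sq (det (suc n) (minor i (punchIn i j) A ∘ cycle j))
        ≡⟨ cong sq (det-cycleʳ n (minor i (punchIn i j) A) j) ⟩
      sq (sgn j * det (suc n) (minor i (punchIn i j) A))
        ≡⟨ sq-sgn-* j _ ⟩
      minorSq i (punchIn i j) A ∎)
  }

-- In a principal minor the same cycle acts on rows and columns, so the signs cancel within each
-- factor.
minorProduct-equivariant : ∀ n → Equivariant {n} minorProduct
minorProduct-equivariant n = record
  { respects = λ i j E → cong₂ _*_ (det-cong (suc n) (minor-cong i i E)) (det-cong (suc n) (minor-cong j j E))
  ; one = λ i A → refl
  ; two = λ i j A → sym (cong₂ _*_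
      (det-relabel-cycle n j (minor i i A))
      (trans (det-cong (suc n) λ k l → cong₂ A (twoPoint-punchIn₁ i j k) (twoPoint-punchIn₁ i j l))
             (det-relabel-cycle n (pinch j i) (minor (punchIn i j) (punchIn i j) A))))
  }

-- The value `h` does not depend on the arc `a` between the first two vertices; summing over that
-- arc doubles the result, hence the outer factor `2^ suc n`.
T-border₂ : ∀ n (f : Matrix (suc (suc n)) → ℤ) (h : Matrix n → Vector ℤ n → Vector ℤ n → ℤ) (H : Matrix n → ℤ) →
  (∀ a v w {A} → Skew A → f (border (a ∷ᵥ v) (border w A)) ≡ h A v w) →
  (∀ {A} → Skew A → V n (λ v → V n (λ w → h A v w)) ≡ 2^ n * (2^ n * H A)) →
  T (suc (suc n)) f ≡ 2^ suc n * (2^ n * T n H)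
T-border₂ n f h H f≡h average = begin
  T (suc (suc n)) f
    ≡⟨ cong₂ _+_ (halves 1ℤ) (halves -1ℤ) ⟩
  2^ n * (2^ n * T n H) + 2^ n * (2^ n * T n H)
    ≡⟨ twice (2^ n) (2^ n * T n H) ⟩
  2^ suc n * (2^ n * T n H) ∎
  where
  twice : ∀ p x → p * x + p * x ≡ + 2 * p * x
  twice = solve-∀
  halves : ∀ a → V n (λ v → V n λ w → T n λ A → f (border (a ∷ᵥ v) (border w A))) ≡ 2^ n * (2^ n * T n H)
  halves a = begin
    V n (λ v → V n λ w → T n λ A → f (border (a ∷ᵥ v) (border w A)))
      ≡⟨ V-cong n (λ v → V-cong n λ w → T-cong n λ A skew → f≡h a v w skew) ⟩
    V n (λ v → V n λ w → T n λ A → h A v w)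
      ≡⟨ V-cong n (λ v → L-V (T-linear n) n λ w A → h A v w) ⟨
    V n (λ v → T n λ A → V n λ w → h A v w)
      ≡⟨ L-V (T-linear n) n (λ v A → V n λ w → h A v w) ⟨
    T n (λ A → V n λ v → V n λ w → h A v w)
      ≡⟨ T-cong n (λ A skew → average skew) ⟩
    T n (λ A → 2^ n * (2^ n * H A))
      ≡⟨ L-* (T-linear n) (2^ n) (λ A → 2^ n * H A) ⟩
    2^ n * T n (λ A → 2^ n * H A)
      ≡⟨ cong (2^ n *_) (L-* (T-linear n) (2^ n) H) ⟩
    2^ n * (2^ n * T n H) ∎

-- Recursions for the second moments.

-- The arguments of S, P and D are one less than the order of the matrices.
Z S P D : ℕ → ℤ
Z n = T n λ A → sq (det n A)
S n = T (suc n) λ A → sum λ i → sum λ j → minorSq i j A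
P n = T (suc n) λ A → sum λ i → sum λ j → minorProduct i j A
D n = T (suc n) λ A → sum λ i → minorSq i i A

T-minorSq₀₀ : ∀ n → T (suc n) (minorSq zero zero) ≡ 2^ n * Z n
T-minorSq₀₀ n = V-const n (Z n)

D-formula : ∀ n → D n ≡ + suc n * (2^ n * Z n)
D-formula n = begin
  D n
    ≡⟨ L-sum (T-linear (suc n)) (λ i A → minorSq i i A) ⟩
  sum (λ i → T (suc n) (λ A → minorSq i i A))
    ≡⟨ sum-cong-≗ (λ i → trans
         (T-cycle n i {minorSq zero zero} (λ E → cong sq (det-cong n (minor-cong zero zero E))))
         (T-minorSq₀₀ n)) ⟩
  sum {suc n} (λ _ → 2^ n * Z n)
    ≡⟨ sum-const (suc n) (2^ n * Z n) ⟩
  + suc n * (2^ n * Z n) ∎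

sq-cof : ∀ {n} (A : Matrix (suc n)) i j → sq (cof A i j) ≡ minorSq i j A
sq-cof {n} A i j = trans (sq-sgn-* i _) (sq-sgn-* j (det n (minor i j A)))

cof-diagonal : ∀ {n} (A : Matrix (suc n)) i → cof A i i ≡ det n (minor i i A)
cof-diagonal {n} A i = begin
  sgn i * (sgn i * det n (minor i i A)) ≡⟨ *-assoc (sgn i) (sgn i) _ ⟨
  sgn i * sgn i * det n (minor i i A)   ≡⟨ cong (_* det n (minor i i A)) (sgn-involutive i) ⟩
  1ℤ * det n (minor i i A)              ≡⟨ *-identityˡ _ ⟩
  det n (minor i i A)                   ∎

sq-trace-cof : ∀ {n} (A : Matrix (suc n)) → sq (trace (cof A)) ≡ sum λ i → sum λ j → minorProduct i j A
sq-trace-cof {n} A = begin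
  sq (trace (cof A))                   ≡⟨ cong sq (sum-cong-≗ (cof-diagonal A)) ⟩
  sum d * sum d                        ≡⟨ *-distribʳ-sum (sum d) d ⟩
  sum (λ i → d i * sum d)              ≡⟨ sum-cong-≗ (λ i → *-distribˡ-sum (d i) d) ⟩
  sum (λ i → sum (λ j → d i * d j))    ∎
  where
  d : Vector ℤ (suc n)
  d i = det n (minor i i A)

frobenius-cof : ∀ {n} (A : Matrix (suc n)) → frobenius (cof A) ≡ sum λ i → sum λ j → minorSq i j A
frobenius-cof A = sum-cong-≗ λ i → sum-cong-≗ λ j → sq-cof A i j

diagonal-cof : ∀ {n} (A : Matrix (suc n)) → diagonal (cof A) ≡ sum λ i → minorSq i i A
diagonal-cof A = sum-cong-≗ λ i → sq-cof A i i

Z-step : ∀ k → let n = double k in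
  Z (suc (suc n)) ≡ 2^ suc n * (P n + + 2 * S n + - (+ 2 * D n))
Z-step k = begin
  V (suc n) (λ v → T (suc n) λ A → sq (det (suc (suc n)) (border v A)))
    ≡⟨ V-cong (suc n) (λ v → T-cong (suc n) λ A skew → cong sq
         (det-skew-odd-bordered k skew (border v A) v v (λ _ → refl) (λ _ → refl) (λ _ _ → refl))) ⟩
  V (suc n) (λ v → T (suc n) λ A → sq (quadratic (cof A) v))
    ≡⟨ L-V (T-linear (suc n)) (suc n) (λ v A → sq (quadratic (cof A) v)) ⟨
  T (suc n) (λ A → V (suc n) λ v → sq (quadratic (cof A) v))
    ≡⟨ T-cong (suc n) (λ A skew → trans (V-sq-quadratic (suc n) (cof A) (cof-sym k skew))
         (cong (2^ suc n *_) (cong₂ _+_ (cong₂ (λ x y → x + + 2 * y) (sq-trace-cof A) (frobenius-cof A))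
            (trans (cong (λ x → - (+ 2 * x)) (diagonal-cof A)) (neg-twice (d A)))))) ⟩
  T (suc n) (λ A → 2^ suc n * (p A + + 2 * s A + - + 2 * d A))
    ≡⟨ L-* (T-linear (suc n)) (2^ suc n) (λ A → p A + + 2 * s A + - + 2 * d A) ⟩
  2^ suc n * T (suc n) (λ A → p A + + 2 * s A + - + 2 * d A)
    ≡⟨ cong (2^ suc n *_) (trans (L-+ (T-linear (suc n)) (λ A → p A + + 2 * s A) (λ A → - + 2 * d A))
         (cong₂ _+_ (trans (L-+ (T-linear (suc n)) p (λ A → + 2 * s A)) (cong (_+_ (P n)) (L-* (T-linear (suc n)) (+ 2) s)))
                    (trans (L-* (T-linear (suc n)) (- + 2) d) (sym (neg-twice (D n)))))) ⟩
  2^ suc n * (P n + + 2 * S n + - (+ 2 * D n)) ∎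
  where
  n : ℕ
  n = double k
  p s d : Matrix (suc n) → ℤ
  p A = sum λ i → sum λ j → minorProduct i j A
  s A = sum λ i → sum λ j → minorSq i j A
  d A = sum λ i → minorSq i i A
  neg-twice : ∀ x → - (+ 2 * x) ≡ - + 2 * x
  neg-twice = solve-∀

-- The term in `z` comes from the n + 3 diagonal positions, the term in `x` from the (n+3)(n+2)
-- off-diagonal ones. `S` and `P` obey this same function, so equal starting values keep them equal.
recursion : ℕ → ℤ → ℤ → ℤ
recursion n z x = + suc (suc (suc n)) * (2^ suc (suc n) * z + + suc (suc n) * (2^ suc (suc n) * (2^ suc n * x)))

S-step : ∀ k → S (suc (suc (double k))) ≡ recursion (double k) (Z (suc (suc (double k)))) (S (double k))
S-step k = trans (T-double-sum (suc n) (minorSq-equivariant (suc n)))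
  (cong₂ (λ x y → + suc (suc (suc n)) * (x + + suc (suc n) * y)) (T-minorSq₀₀ (suc (suc n)))
    (T-border₂ (suc n) (minorSq zero (suc zero)) (λ A v w → sq (bilinear (cof A) v w))
      (λ A → sum λ i → sum λ j → minorSq i j A)
      -- Deleting row 0 and column 1 leaves `A` with first row `w`, first column `- v` and corner
      -- `- a`.
      (λ a v w {A} skew → cong sq (det-skew-odd-bordered k skew
         (minor zero (suc zero) (border (a ∷ᵥ v) (border w A))) v w (λ _ → refl) (λ _ → refl) (λ _ _ → refl)))
      (λ {A} skew → trans (V-sq-bilinear (suc n) (cof A))
         (cong (λ x → 2^ suc n * (2^ suc n * x)) (frobenius-cof A)))))
  where
  n : ℕ
  n = double k

V-product : ∀ n (f g : Vector ℤ n → ℤ) → V n (λ v → V n λ w → f w * g v) ≡ V n f * V n g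
V-product n f g = begin
  V n (λ v → V n λ w → f w * g v) ≡⟨ V-cong n (λ v → trans (V-cong n λ w → *-comm (f w) (g v)) (trans (L-* (V-linear n) (g v) f) (*-comm (g v) (V n f)))) ⟩
  V n (λ v → V n f * g v)         ≡⟨ L-* (V-linear n) (V n f) g ⟩
  V n f * V n g                   ∎

-- Deleting vertex 0 leaves `border w A` and deleting vertex 1 leaves `border v A`. As v and w are
-- independent, the mean of the product is the square of the mean tr c, which is again the sum of
-- all products of principal minors of `A`.
P-step : ∀ k → P (suc (suc (double k))) ≡ recursion (double k) (Z (suc (suc (double k)))) (P (double k))
P-step k = trans (T-double-sum (suc n) (minorProduct-equivariant (suc n)))
  (cong₂ (λ x y → + suc (suc (suc n)) * (x + + suc (suc n) * y)) (T-minorSq₀₀ (suc (suc n)))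
    (T-border₂ (suc n) (minorProduct zero (suc zero)) (λ A v w → quadratic (cof A) w * quadratic (cof A) v)
      (λ A → sum λ i → sum λ j → minorProduct i j A)
      (λ a v w {A} skew → cong₂ _*_
         (det-skew-odd-bordered k skew (border w A) w w (λ _ → refl) (λ _ → refl) (λ _ _ → refl))
         (det-skew-odd-bordered k skew
           (minor (suc zero) (suc zero) (border (a ∷ᵥ v) (border w A))) v v (λ _ → refl) (λ _ → refl) (λ _ _ → refl)))
      (λ {A} skew → begin
        V (suc n) (λ v → V (suc n) λ w → quadratic (cof A) w * quadratic (cof A) v)
          ≡⟨ V-product (suc n) (quadratic (cof A)) (quadratic (cof A)) ⟩
        V (suc n) (quadratic (cof A)) * V (suc n) (quadratic (cof A))
          ≡⟨ cong sq (V-quadratic (suc n) (cof A) (cof-sym k skew)) ⟩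
        sq (2^ suc n * trace (cof A))
          ≡⟨ regroup (2^ suc n) (trace (cof A)) ⟩
        2^ suc n * (2^ suc n * sq (trace (cof A)))
          ≡⟨ cong (λ x → 2^ suc n * (2^ suc n * x)) (sq-trace-cof A) ⟩
        _ ∎)))
  where
  n : ℕ
  n = double k
  regroup : ∀ p t → (p * t) * (p * t) ≡ p * (p * (t * t))
  regroup = solve-∀

-- Normalised moments and their closed form.

#T : ℕ → ℤ
#T n = T n λ _ → 1ℤ

#T-suc : ∀ n → #T (suc n) ≡ 2^ n * #T n
#T-suc n = V-const n (#T n)

-- The expectations of det² at order 2k and of the sum of all squared minors at order 2k + 1.
z s : ℕ → ℤ
z zero = 1ℤ
z (suc k) = + 3 * s k + - (+ 2 * (+ suc (double k) * z k))
s zero = 1ℤ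
s (suc k) = + suc (suc (suc (double k))) * (z (suc k) + + suc (suc (double k)) * s k)

record Moments (k : ℕ) : Set where
  field
    Z≡ : Z (double k) ≡ #T (double k) * z k
    S≡ : S (double k) ≡ #T (suc (double k)) * s k
    P≡ : P (double k) ≡ #T (suc (double k)) * s k
open Moments

-- The three claims advance together: the next `Z` uses all of them, and the next `S` and `P` use
-- that new `Z`.
moments : ∀ k → Moments k
Z≡ (moments zero) = refl
S≡ (moments zero) = refl
P≡ (moments zero) = refl
moments (suc k) = record
  { Z≡ = Z-next
  ; S≡ = trans (S-step k) (recursion-normalise (S≡ (moments k)))
  ; P≡ = trans (P-step k) (recursion-normalise (P≡ (moments k)))
  }
  where
  n : ℕ
  n = double k
  Z-next : Z (suc (suc n)) ≡ #T (suc (suc n)) * z (suc k)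
  Z-next = begin
    Z (suc (suc n))
      ≡⟨ Z-step k ⟩
    2^ suc n * (P n + + 2 * S n + - (+ 2 * D n))
      ≡⟨ cong (2^ suc n *_) (cong₂ _+_ (cong₂ (λ p s → p + + 2 * s) (P≡ (moments k)) (S≡ (moments k)))
           (cong (λ d → - (+ 2 * d)) (trans (D-formula n) (cong (λ x → + suc n * (2^ n * x)) (Z≡ (moments k)))))) ⟩
    2^ suc n * (#T (suc n) * s k + + 2 * (#T (suc n) * s k) + - (+ 2 * (+ suc n * (2^ n * (#T n * z k)))))
      ≡⟨ cong (λ t → 2^ suc n * (t * s k + + 2 * (t * s k) + - (+ 2 * (+ suc n * (2^ n * (#T n * z k)))))) (#T-suc n) ⟩
    _ ≡⟨ collect (2^ suc n) (2^ n) (#T n) (s k) (+ suc n) (z k) ⟩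
    2^ suc n * (2^ n * #T n) * z (suc k)
      ≡⟨ cong (_* z (suc k)) (trans (cong (2^ suc n *_) (sym (#T-suc n))) (sym (#T-suc (suc n)))) ⟩
    #T (suc (suc n)) * z (suc k) ∎
    where
    collect : ∀ q p t s m z →
      q * (p * t * s + + 2 * (p * t * s) + - (+ 2 * (m * (p * (t * z))))) ≡ q * (p * t) * (+ 3 * s + - (+ 2 * (m * z)))
    collect = solve-∀
  recursion-normalise : ∀ {x} → x ≡ #T (suc n) * s k →
    recursion n (Z (suc (suc n))) x ≡ #T (suc (suc (suc n))) * s (suc k)
  recursion-normalise {x} e = begin
    recursion n (Z (suc (suc n))) x
      ≡⟨ cong₂ (recursion n) (trans Z-next (cong (_* z (suc k)) (#T-suc (suc n)))) e ⟩
    recursion n (2^ suc n * #T (suc n) * z (suc k)) (#T (suc n) * s k)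
      ≡⟨ collect (2^ suc (suc n)) (2^ suc n) (#T (suc n)) (+ suc (suc (suc n))) (z (suc k)) (+ suc (suc n)) (s k) ⟩
    2^ suc (suc n) * (2^ suc n * #T (suc n)) * s (suc k)
      ≡⟨ cong (_* s (suc k)) (trans (cong (2^ suc (suc n) *_) (sym (#T-suc (suc n)))) (sym (#T-suc (suc (suc n))))) ⟩
    #T (suc (suc (suc n))) * s (suc k) ∎
    where
    collect : ∀ r q t m z l s →
      m * (r * (q * t * z) + l * (r * (q * (t * s)))) ≡ r * (q * t) * (m * (z + l * s))
    collect = solve-∀

-- Elimination of `s` by 3 s_k = z_(k+1) + 2(n+1) z_k with n = 2k; after unfolding it is a
-- polynomial identity in `double k`, `s k` and `z k`.
z-recurrence : ∀ k → let e = + double k in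
  z (suc (suc k)) ≡ (+ 3 + e) * ((+ 3 + e) * z (suc k) + (+ 4 + + 2 * e) * ((1ℤ + e) * z k))
z-recurrence k = solve (+ double k) (s k) (z k)
  where
  solve : ∀ e s z →
    + 3 * ((+ 3 + e) * ((+ 3 * s + - (+ 2 * ((1ℤ + e) * z))) + (+ 2 + e) * s)) +
      - (+ 2 * ((+ 3 + e) * (+ 3 * s + - (+ 2 * ((1ℤ + e) * z))))) ≡
    (+ 3 + e) * ((+ 3 + e) * (+ 3 * s + - (+ 2 * ((1ℤ + e) * z))) + (+ 4 + + 2 * e) * ((1ℤ + e) * z))
  solve = solve-∀

-- At k = 0 truncated subtraction gives `0 !!`, whose value 1 is that of (-1)!!, so no exception
-- arises.
!!-suc-double : ∀ k → suc (double k) !! ≡ suc (double k) ℕ.* ((double k ∸ 1) !!)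
!!-suc-double zero = refl
!!-suc-double (suc k) = refl

-- Two consecutive values are carried because the recurrence has order two. Splitting (n+3)!! into
-- (n+3)(n+1)(n-1)!! leaves exactly the recurrence of `y`.
z-closed : ∀ k → z k ≡ + (y (double k) ℕ.* ((double k ∸ 1) !!)) ×
                 z (suc k) ≡ + (y (double (suc k)) ℕ.* ((double (suc k) ∸ 1) !!))
z-closed zero = refl , refl
z-closed (suc k) with z-closed k
... | z₀ , z₁ = z₁ , (begin
  z (suc (suc k))
    ≡⟨ z-recurrence k ⟩
  (+ 3 + e) * ((+ 3 + e) * z (suc k) + (+ 4 + + 2 * e) * ((1ℤ + e) * z k))
    ≡⟨ cong₂ (λ a b → (+ 3 + e) * ((+ 3 + e) * a + (+ 4 + + 2 * e) * ((1ℤ + e) * b)))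
         (trans z₁ (trans (pos-* y₁ (suc n !!)) (cong (+ y₁ *_) (trans (cong +_ (!!-suc-double k)) (pos-* (suc n) f)))))
         (trans z₀ (pos-* y₀ f)) ⟩
  (+ 3 + e) * ((+ 3 + e) * (+ y₁ * ((1ℤ + e) * + f)) + (+ 4 + + 2 * e) * ((1ℤ + e) * (+ y₀ * + f)))
    ≡⟨ collect e (+ y₁) (+ y₀) (+ f) ⟩
  ((+ 3 + e) * + y₁ + (+ 4 + + 2 * e) * + y₀) * ((+ 3 + e) * ((1ℤ + e) * + f))
    ≡⟨ cong₂ _*_ y-cast f-cast ⟨
  + y (double (suc (suc k))) * + (suc (suc (suc n)) !!)
    ≡⟨ pos-* (y (double (suc (suc k)))) (suc (suc (suc n)) !!) ⟨
  + (y (double (suc (suc k))) ℕ.* (suc (suc (suc n)) !!)) ∎)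
  where
  n y₀ y₁ f : ℕ
  n = double k
  y₀ = y n
  y₁ = y (suc (suc n))
  f = (n ∸ 1) !!
  e : ℤ
  e = + n
  collect : ∀ e y₁ y₀ f →
    (+ 3 + e) * ((+ 3 + e) * (y₁ * ((1ℤ + e) * f)) + (+ 4 + + 2 * e) * ((1ℤ + e) * (y₀ * f))) ≡
    ((+ 3 + e) * y₁ + (+ 4 + + 2 * e) * y₀) * ((+ 3 + e) * ((1ℤ + e) * f))
  collect = solve-∀
  y-cast : + y (double (suc (suc k))) ≡ (+ 3 + e) * + y₁ + (+ 4 + + 2 * e) * + y₀
  y-cast = cong₂ _+_ (pos-* (3 ℕ.+ n) y₁)
    (trans (pos-* (4 ℕ.+ 2 ℕ.* n) y₀) (cong (λ x → (+ 4 + x) * + y₀) (pos-* 2 n)))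
  f-cast : + (suc (suc (suc n)) !!) ≡ (+ 3 + e) * ((1ℤ + e) * + f)
  f-cast = trans (pos-* (3 ℕ.+ n) (suc n !!))
    (cong ((+ 3 + e) *_) (trans (cong +_ (!!-suc-double k)) (pos-* (suc n) f)))

second-moment : ∀ k → Z (double k) ≡ #T (double k) * + (y (double k) ℕ.* ((double k ∸ 1) !!))
second-moment k = trans (Z≡ (moments k)) (cong (#T (double k) *_) (proj₁ (z-closed k)))

-- The list of tournaments enumerates the same sum as `T`.

sumOver : {A : Set} → List A → (A → ℤ) → ℤ
sumOver xs f = sumℤ (map f xs)

sumOver-linear : {A : Set} (xs : List A) → Linear (sumOver xs)
L-cong (sumOver-linear []) e = refl
L-cong (sumOver-linear (x ∷ xs)) e = cong₂ _+_ (e x) (L-cong (sumOver-linear xs) e)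
L-+ (sumOver-linear []) f g = refl
L-+ (sumOver-linear (x ∷ xs)) f g = trans (cong (_+_ (f x + g x)) (L-+ (sumOver-linear xs) f g))
  (+-interchange (f x) (g x) (sumOver xs f) (sumOver xs g))
L-* (sumOver-linear []) c f = sym (*-zeroʳ c)
L-* (sumOver-linear (x ∷ xs)) c f = trans (cong (_+_ (c * f x)) (L-* (sumOver-linear xs) c f))
  (sym (*-distribˡ-+ c (f x) (sumOver xs f)))

sumOver-cong : {A : Set} (xs : List A) {f g : A → ℤ} → (∀ x → f x ≡ g x) → sumOver xs f ≡ sumOver xs g
sumOver-cong xs = L-cong (sumOver-linear xs)

sumOver-comm : {A B : Set} (xs : List A) (ys : List B) (f : A → B → ℤ) →
  sumOver xs (λ x → sumOver ys (f x)) ≡ sumOver ys (λ y → sumOver xs (λ x → f x y))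
sumOver-comm xs [] f = L-0 (sumOver-linear xs)
sumOver-comm xs (y ∷ ys) f = trans (L-+ (sumOver-linear xs) (λ x → f x y) (λ x → sumOver ys (f x)))
  (cong (_+_ (sumOver xs (λ x → f x y))) (sumOver-comm xs ys f))

sumOver-++ : {A : Set} (xs ys : List A) (f : A → ℤ) → sumOver (xs ++ ys) f ≡ sumOver xs f + sumOver ys f
sumOver-++ [] ys f = sym (+-identityˡ (sumOver ys f))
sumOver-++ (x ∷ xs) ys f = trans (cong (_+_ (f x)) (sumOver-++ xs ys f)) (sym (+-assoc (f x) (sumOver xs f) (sumOver ys f)))

sumOver-concatMap : {A B : Set} (h : A → List B) (xs : List A) (f : B → ℤ) →
  sumOver (concatMap h xs) f ≡ sumOver xs (λ x → sumOver (h x) f)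
sumOver-concatMap h [] f = refl
sumOver-concatMap h (x ∷ xs) f =
  trans (sumOver-++ (h x) (concatMap h xs) f) (cong (_+_ (sumOver (h x) f)) (sumOver-concatMap h xs f))

sumOver-filter : {A : Set} {P : A → Set} (P? : Decidable P) (xs : List A) (f : A → ℤ) →
  sumOver (filter P? xs) f ≡ sumOver xs (λ x → if does (P? x) then f x else 0ℤ)
sumOver-filter P? [] f = refl
sumOver-filter P? (x ∷ xs) f with does (P? x)
... | true = cong (_+_ (f x)) (sumOver-filter P? xs f)
... | false = trans (sumOver-filter P? xs f) (sym (+-identityˡ _))

sumOver-length : {A : Set} (xs : List A) → sumOver xs (λ _ → 1ℤ) ≡ + length xs
sumOver-length [] = refl
sumOver-length (x ∷ xs) = cong (_+_ 1ℤ) (sumOver-length xs)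

sumOver-allFuns-suc : {A : Set} (xs : List A) (n : ℕ) {G : Vector A (suc n) → ℤ} →
  (∀ {f g} → (∀ i → f i ≡ g i) → G f ≡ G g) →
  sumOver (allFuns xs (suc n)) G ≡ sumOver xs (λ a → sumOver (allFuns xs n) (λ f → G (a ∷ᵥ f)))
sumOver-allFuns-suc xs n {G} G-cong = trans (sumOver-concatMap _ xs G)
  (sumOver-cong xs λ a → trans (cong sumℤ (sym (map-∘ (allFuns xs n))))
    (sumOver-cong (allFuns xs n) λ f → G-cong λ { zero → refl ; (suc i) → refl }))

-- `allFuns` lists a matrix row by row, but removing a vertex removes a row and a column. Induction
-- on the number of rows, with an exchange of sums at each row, splits off the first column.
sumOver-allFuns-columns : {A : Set} (xs : List A) (m n : ℕ) {G : Vector (Vector A (suc m)) n → ℤ} →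
  (∀ {f g} → (∀ i j → f i j ≡ g i j) → G f ≡ G g) →
  sumOver (allFuns (allFuns xs (suc m)) n) G ≡
    sumOver (allFuns xs n) (λ c → sumOver (allFuns (allFuns xs m) n) (λ B → G (λ i → c i ∷ᵥ B i)))
sumOver-allFuns-columns xs m zero {G} G-cong =
  trans (cong (_+ 0ℤ) (G-cong λ ())) (sym (+-identityʳ _))
sumOver-allFuns-columns xs m (suc n) {G} G-cong = begin
  sumOver (allFuns (allFuns xs (suc m)) (suc n)) G
    ≡⟨ sumOver-allFuns-suc (allFuns xs (suc m)) n (λ e → G-cong λ i j → cong (λ r → r j) (e i)) ⟩
  sumOver (allFuns xs (suc m)) (λ r → sumOver (allFuns (allFuns xs (suc m)) n) (λ B → G (r ∷ᵥ B)))
    ≡⟨ sumOver-cong (allFuns xs (suc m)) (λ r → sumOver-allFuns-columns xs m n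
         (λ e → G-cong λ { zero j → refl ; (suc i) j → e i j })) ⟩
  sumOver (allFuns xs (suc m)) (λ r → sumOver cs λ c → sumOver Bs λ B → G (r ∷ᵥ (λ i → c i ∷ᵥ B i)))
    ≡⟨ sumOver-allFuns-suc xs m (λ e → sumOver-cong cs λ c → sumOver-cong Bs λ B →
         G-cong λ { zero j → e j ; (suc i) j → refl }) ⟩
  sumOver xs (λ a → sumOver rs λ r → sumOver cs λ c → sumOver Bs λ B → G ((a ∷ᵥ r) ∷ᵥ (λ i → c i ∷ᵥ B i)))
    ≡⟨ sumOver-cong xs (λ a → sumOver-comm rs cs _) ⟩
  sumOver xs (λ a → sumOver cs λ c → sumOver rs λ r → sumOver Bs λ B → G ((a ∷ᵥ r) ∷ᵥ (λ i → c i ∷ᵥ B i)))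
    ≡⟨ sumOver-cong xs (λ a → sumOver-cong cs λ c → trans
         (sumOver-cong rs λ r → sumOver-cong Bs λ B → G-cong λ { zero j → refl ; (suc i) j → refl })
         (sym (sumOver-allFuns-suc rs n (λ e → G-cong λ i j → cong (λ r → ((a ∷ᵥ c) i ∷ᵥ r) j) (e i))))) ⟩
  sumOver xs (λ a → sumOver cs λ c → sumOver (allFuns rs (suc n)) λ B → G (λ i → (a ∷ᵥ c) i ∷ᵥ B i))
    ≡⟨ sumOver-allFuns-suc xs n (λ e → sumOver-cong (allFuns rs (suc n)) λ B →
         G-cong λ { i zero → e i ; i (suc j) → refl }) ⟨
  sumOver (allFuns xs (suc n)) (λ c → sumOver (allFuns rs (suc n)) λ B → G (λ i → c i ∷ᵥ B i)) ∎
  where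
  rs = allFuns xs m
  cs = allFuns xs n
  Bs = allFuns rs n

andFin-suc : ∀ n (p : Fin (suc n) → Bool) → andFin (suc n) p ≡ p zero ∧ andFin n (p ∘ suc)
andFin-suc n p = cong (λ l → p zero ∧ foldr _∧_ true l)
  (trans (map-tabulate suc p) (sym (map-tabulate (λ i → i) (p ∘ suc))))

andFin-cong : ∀ n {p q : Fin n → Bool} → (∀ i → p i ≡ q i) → andFin n p ≡ andFin n q
andFin-cong n e = cong (foldr _∧_ true) (map-cong e (allFin n))

∧-interchange : ∀ a b c d → (a ∧ b) ∧ (c ∧ d) ≡ (a ∧ c) ∧ (b ∧ d)
∧-interchange = CommutativeSemigroupProperties.interchange
  (CommutativeMonoid.commutativeSemigroup ∧-commutativeMonoid)

andFin-∧ : ∀ n (p q : Fin n → Bool) → andFin n (λ i → p i ∧ q i) ≡ andFin n p ∧ andFin n q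
andFin-∧ zero p q = refl
andFin-∧ (suc n) p q = begin
  andFin (suc n) (λ i → p i ∧ q i)
    ≡⟨ andFin-suc n (λ i → p i ∧ q i) ⟩
  (p zero ∧ q zero) ∧ andFin n (λ i → p (suc i) ∧ q (suc i))
    ≡⟨ cong ((p zero ∧ q zero) ∧_) (andFin-∧ n (p ∘ suc) (q ∘ suc)) ⟩
  (p zero ∧ q zero) ∧ (andFin n (p ∘ suc) ∧ andFin n (q ∘ suc))
    ≡⟨ ∧-interchange (p zero) (q zero) _ _ ⟩
  (p zero ∧ andFin n (p ∘ suc)) ∧ (q zero ∧ andFin n (q ∘ suc))
    ≡⟨ cong₂ _∧_ (andFin-suc n p) (andFin-suc n q) ⟨
  andFin (suc n) p ∧ andFin (suc n) q ∎

extend : ∀ {n} → Bool → Vector Bool n → Vector Bool n → Digraph n → Digraph (suc n)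
extend b v c A = (b ∷ᵥ v) ∷ᵥ (λ i → c i ∷ᵥ A i)

opposite : ∀ {n} → Vector Bool n → Vector Bool n → Bool
opposite {n} v c = andFin n λ j → v j xor c j

-- Each pair of vertex 0 with another vertex is tested from both ends, so `opposite v c` occurs
-- twice and is merged by idempotence.
isTournament-extend : ∀ {n} b v c (A : Digraph n) →
  isTournament (extend b v c A) ≡ not b ∧ (opposite v c ∧ isTournament A)
isTournament-extend {n} b v c A = begin
  isTournament (extend b v c A)
    ≡⟨ andFin-suc n _ ⟩
  andFin (suc n) (entry zero) ∧ andFin n (λ i → andFin (suc n) (entry (suc i)))
    ≡⟨ cong₂ _∧_ (andFin-suc n (entry zero)) (andFin-cong n λ i → andFin-suc n (entry (suc i))) ⟩
  (not b ∧ opposite v c) ∧ andFin n (λ i → (c i xor v i) ∧ andFin n (entry (suc i) ∘ suc))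
    ≡⟨ cong ((not b ∧ opposite v c) ∧_) (trans (andFin-∧ n (λ i → c i xor v i) _)
         (cong (_∧ isTournament A) (andFin-cong n λ i → xor-comm (c i) (v i)))) ⟩
  (not b ∧ opposite v c) ∧ (opposite v c ∧ isTournament A)
    ≡⟨ ∧-assoc (not b) (opposite v c) _ ⟩
  not b ∧ (opposite v c ∧ (opposite v c ∧ isTournament A))
    ≡⟨ cong (not b ∧_) (trans (sym (∧-assoc (opposite v c) (opposite v c) (isTournament A)))
         (cong (_∧ isTournament A) (∧-idem (opposite v c)))) ⟩
  not b ∧ (opposite v c ∧ isTournament A) ∎
  where
  entry : Fin (suc n) → Fin (suc n) → Bool
  entry i j = if does (i ≟ j) then not (extend b v c A i i) else (extend b v c A i j xor extend b v c A j i)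

isTournament-cong : ∀ {n} {A B : Digraph n} → (∀ i j → A i j ≡ B i j) → isTournament A ≡ isTournament B
isTournament-cong {n} e = andFin-cong n λ i → andFin-cong n λ j →
  cong₂ (if does (i ≟ j) then_else_) (cong not (e i i)) (cong₂ _xor_ (e i j) (e j i))

seidel-cong : ∀ {n} {A B : Digraph n} → (∀ i j → A i j ≡ B i j) → seidel A ≋ seidel B
seidel-cong e i j = cong (λ b → if does (i ≟ j) then 0ℤ else (if b then 1ℤ else -1ℤ)) (e i j)

sign-of : Bool → ℤ
sign-of b = if b then 1ℤ else -1ℤ

seidel-extend : ∀ {n} v (A : Digraph n) →
  seidel (extend false v (not ∘ v) A) ≋ border (sign-of ∘ v) (seidel A)
seidel-extend v A zero zero = refl
seidel-extend v A zero (suc j) = refl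
seidel-extend v A (suc i) zero with v i
... | true = refl
... | false = refl
seidel-extend v A (suc i) (suc j) = refl

when : Bool → ℤ → ℤ
when b x = if b then x else 0ℤ

when-∧ : ∀ a b x → when (a ∧ b) x ≡ when a (when b x)
when-∧ true b x = refl
when-∧ false b x = refl

sumOver-when : {A : Set} (xs : List A) (b : Bool) (f : A → ℤ) → sumOver xs (λ x → when b (f x)) ≡ when b (sumOver xs f)
sumOver-when xs true f = refl
sumOver-when xs false f = L-0 (sumOver-linear xs)

RespectsVec : ∀ {A : Set} {n} → (Vector A n → ℤ) → Set
RespectsVec H = ∀ {f g} → (∀ i → f i ≡ g i) → H f ≡ H g

-- The first column of a tournament is determined by its first row, so all summands but one vanish.
sumOver-opposite : ∀ n (v : Vector Bool n) {H : Vector Bool n → ℤ} → RespectsVec H →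
  sumOver (allFuns allBool n) (λ c → when (opposite v c) (H c)) ≡ H (not ∘ v)
sumOver-opposite zero v H-cong = trans (+-identityʳ _) (H-cong λ ())
sumOver-opposite (suc n) v {H} H-cong = begin
  sumOver (allFuns allBool (suc n)) (λ c → when (opposite v c) (H c))
    ≡⟨ sumOver-allFuns-suc allBool n (λ e → cong₂ when (andFin-cong (suc n) λ j → cong (v j xor_) (e j)) (H-cong e)) ⟩
  sumOver allBool (λ a → sumOver (allFuns allBool n) (λ c → when (opposite v (a ∷ᵥ c)) (H (a ∷ᵥ c))))
    ≡⟨ sumOver-cong allBool (λ a → trans
         (trans (sumOver-cong (allFuns allBool n) λ c → trans
             (cong (λ b → when b (H (a ∷ᵥ c))) (andFin-suc n (λ j → v j xor (a ∷ᵥ c) j)))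
             (when-∧ (v zero xor a) (opposite (v ∘ suc) c) _))
           (sumOver-when (allFuns allBool n) (v zero xor a) _))
         (cong (when (v zero xor a)) (sumOver-opposite n (v ∘ suc)
           {λ c → H (a ∷ᵥ c)} λ e → H-cong λ { zero → refl ; (suc i) → e i }))) ⟩
  sumOver allBool (λ a → when (v zero xor a) (H (a ∷ᵥ (not ∘ v ∘ suc))))
    ≡⟨ select (v zero) ⟩
  H (not (v zero) ∷ᵥ (not ∘ v ∘ suc))
    ≡⟨ H-cong (λ { zero → refl ; (suc i) → refl }) ⟩
  H (not ∘ v) ∎
  where
  select : ∀ b → sumOver allBool (λ a → when (b xor a) (H (a ∷ᵥ (not ∘ v ∘ suc)))) ≡ H (not b ∷ᵥ (not ∘ v ∘ suc))
  select true = trans (+-identityˡ _) (+-identityʳ _)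
  select false = +-identityʳ _

sumOver-signs : ∀ n {H : Vector ℤ n → ℤ} → RespectsVec H →
  sumOver (allFuns allBool n) (λ v → H (sign-of ∘ v)) ≡ V n H
sumOver-signs zero H-cong = trans (+-identityʳ _) (H-cong λ ())
sumOver-signs (suc n) {H} H-cong = begin
  sumOver (allFuns allBool (suc n)) (λ v → H (sign-of ∘ v))
    ≡⟨ sumOver-allFuns-suc allBool n (λ e → H-cong (cong sign-of ∘ e)) ⟩
  sumOver allBool (λ a → sumOver (allFuns allBool n) (λ v → H (sign-of ∘ (a ∷ᵥ v))))
    ≡⟨ sumOver-cong allBool (λ a → trans
         (sumOver-cong (allFuns allBool n) λ v →
           H-cong {sign-of ∘ (a ∷ᵥ v)} {sign-of a ∷ᵥ (sign-of ∘ v)} λ { zero → refl ; (suc i) → refl })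
         (sumOver-signs n {H ∘ (sign-of a ∷ᵥ_)} λ e → H-cong λ { zero → refl ; (suc i) → e i })) ⟩
  V n (H ∘ (1ℤ ∷ᵥ_)) + (V n (H ∘ (-1ℤ ∷ᵥ_)) + 0ℤ)
    ≡⟨ cong (_+_ (V n (H ∘ (1ℤ ∷ᵥ_)))) (+-identityʳ _) ⟩
  V (suc n) H ∎

sumOver-allDigraphs : ∀ n {F : Matrix n → ℤ} → Respects F →
  sumOver (allDigraphs n) (λ A → when (isTournament A) (F (seidel A))) ≡ T n F
sumOver-allDigraphs zero F-cong = trans (+-identityʳ _) (F-cong λ ())
sumOver-allDigraphs (suc n) {F} F-cong = begin
  sumOver (allDigraphs (suc n)) G
    ≡⟨ sumOver-allFuns-suc (allFuns allBool (suc n)) n (λ e → G-cong λ i j → cong (λ r → r j) (e i)) ⟩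
  sumOver (allFuns allBool (suc n)) (λ r → sumOver (allFuns (allFuns allBool (suc n)) n) λ B → G (r ∷ᵥ B))
    ≡⟨ sumOver-cong (allFuns allBool (suc n)) (λ r → sumOver-allFuns-columns allBool n n
         λ e → G-cong λ { zero j → refl ; (suc i) j → e i j }) ⟩
  sumOver (allFuns allBool (suc n)) (λ r → sumOver vs λ c → sumOver (allDigraphs n) λ A → G (r ∷ᵥ (λ i → c i ∷ᵥ A i)))
    ≡⟨ sumOver-allFuns-suc allBool n (λ e → sumOver-cong vs λ c → sumOver-cong (allDigraphs n) λ A →
         G-cong λ { zero j → e j ; (suc i) j → refl }) ⟩
  sumOver allBool (λ b → sumOver vs λ v → sumOver vs λ c → sumOver (allDigraphs n) λ A → G (extend b v c A))
    ≡⟨ sumOver-cong allBool (λ b → trans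
         (sumOver-cong vs λ v → trans
           (sumOver-cong vs λ c → trans
             (sumOver-cong (allDigraphs n) λ A → trans
               (cong (λ t → when t (F (seidel (extend b v c A)))) (isTournament-extend b v c A))
               (when-∧ (not b) (opposite v c ∧ isTournament A) _))
             (sumOver-when (allDigraphs n) (not b) _))
           (sumOver-when vs (not b) _))
         (sumOver-when vs (not b) _)) ⟩
  -- The case `b = true`, a loop at vertex 0, contributes the initial `0ℤ`.
  0ℤ + (sumOver vs (λ v → sumOver vs λ c → sumOver (allDigraphs n) λ A →
    when (opposite v c ∧ isTournament A) (F (seidel (extend false v c A)))) + 0ℤ)
    ≡⟨ trans (+-identityˡ _) (+-identityʳ _) ⟩
  sumOver vs (λ v → sumOver vs λ c → sumOver (allDigraphs n) λ A →
    when (opposite v c ∧ isTournament A) (F (seidel (extend false v c A))))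
    ≡⟨ sumOver-cong vs (λ v → trans
         (sumOver-cong vs λ c → trans
           (sumOver-cong (allDigraphs n) λ A → when-∧ (opposite v c) (isTournament A) _)
           (sumOver-when (allDigraphs n) (opposite v c) _))
         (sumOver-opposite n v λ e → sumOver-cong (allDigraphs n) λ A → cong (when (isTournament A))
           (F-cong (seidel-cong λ { zero j → refl ; (suc i) zero → e i ; (suc i) (suc j) → refl })))) ⟩
  sumOver vs (λ v → sumOver (allDigraphs n) λ A → when (isTournament A) (F (seidel (extend false v (not ∘ v) A))))
    ≡⟨ sumOver-cong vs (λ v → trans
         (sumOver-cong (allDigraphs n) λ A → cong (when (isTournament A)) (F-cong (seidel-extend v A)))
         (sumOver-allDigraphs n {F ∘ border (sign-of ∘ v)} λ E → F-cong (border-cong (λ _ → refl) E))) ⟩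
  sumOver vs (λ v → T n (F ∘ border (sign-of ∘ v)))
    ≡⟨ sumOver-signs n {λ v → T n (F ∘ border v)} (λ e → T-cong n λ A _ → F-cong (border-cong {A = A} {A} e λ _ _ → refl)) ⟩
  T (suc n) F ∎
  where
  vs = allFuns allBool n
  G : Digraph (suc n) → ℤ
  G A = when (isTournament A) (F (seidel A))
  G-cong : ∀ {A B} → (∀ i j → A i j ≡ B i j) → G A ≡ G B
  G-cong e = cong₂ when (isTournament-cong e) (F-cong (seidel-cong e))

sumOver-tournaments : ∀ n {F : Matrix n → ℤ} → Respects F → sumOver (tournaments n) (F ∘ seidel) ≡ T n F
sumOver-tournaments n {F} F-cong = begin
  sumOver (tournaments n) (F ∘ seidel)
    ≡⟨ sumOver-filter (λ A → isTournament A Bool.≟ true) (allDigraphs n) (F ∘ seidel) ⟩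
  _ ≡⟨ sumOver-cong (allDigraphs n) (λ A → cong (λ b → when b (F (seidel A))) (does-≟-true (isTournament A))) ⟩
  sumOver (allDigraphs n) (λ A → when (isTournament A) (F (seidel A)))
    ≡⟨ sumOver-allDigraphs n F-cong ⟩
  T n F ∎
  where
  does-≟-true : ∀ b → does (b Bool.≟ true) ≡ b
  does-≟-true true = refl
  does-≟-true false = refl

double≡2* : ∀ m → double m ≡ 2 ℕ.* m
double≡2* zero = refl
double≡2* (suc m) = trans (cong (λ k → suc (suc k)) (double≡2* m)) (cong suc (sym (ℕₚ.+-suc m (m ℕ.+ 0))))

theorem4p2 : (m : ℕ) → (n : ℕ) → n ≡ 2 ℕ.* m →
    sumℤ (map (λ A → det n (seidel A) * det n (seidel A)) (tournaments n))
    ≡ + (length (tournaments n) ℕ.* (y n ℕ.* ((n ∸ 1) !!)))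
-- Replacing `n` by `double m` lets the two-step recursions compute. The expectation is stated
-- multiplied by the number of tournaments, which is `#T d`, the sum of the constant 1.
theorem4p2 m n n≡2m rewrite trans n≡2m (sym (double≡2* m)) = begin
  sumOver (tournaments d) (λ A → sq (det d (seidel A)))
    ≡⟨ sumOver-tournaments d {λ M → sq (det d M)} (λ E → cong sq (det-cong d E)) ⟩
  Z d
    ≡⟨ second-moment m ⟩
  #T d * + (y d ℕ.* ((d ∸ 1) !!))
    ≡⟨ cong (_* + (y d ℕ.* ((d ∸ 1) !!)))
         (trans (sym (sumOver-tournaments d {λ _ → 1ℤ} (λ _ → refl))) (sumOver-length (tournaments d))) ⟩
  + length (tournaments d) * + (y d ℕ.* ((d ∸ 1) !!))
    ≡⟨ pos-* (length (tournaments d)) (y d ℕ.* ((d ∸ 1) !!)) ⟨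
  + (length (tournaments d) ℕ.* (y d ℕ.* ((d ∸ 1) !!))) ∎
  where
  d : ℕ
  d = double m
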